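{- Let $n\ge 3$, let $c\in\{0,1\}$ be such that $\lfloor\frac{n-1}{2}\rfloor-1\equiv c\pmod 2$, and let $f:E(K_n)\to\{ -1,1\}$ satisfy \[\min\{e(-1),e(1)\} > \binom{n}{2}-\binom{n-\lfloor\frac{n-3}{4}\rfloor}{2}+c.\] Then $K_n$ contains a spanning path $P$ (Hamiltonian path) with $|f(P)|\le 1$. Moreover, the bound is sharp: there is a colouring $f:E(K_n)\to\{ -1,1\}$ with $\min\{e(-1),e(1)\}=\binom{n}{2}-\binom{n-\lfloor\frac{n-3}{4}\rfloor}{2}+c$ such that no spanning path $P$ of $K_n$ has $|f(P)|\le 1$.
   Context: For $f:E(K_n)\to\{ -1,1\}$ and a subgraph $H$, $f(H)=\sum_{e\in E(H)}f(e)$; $e(-1)$ and $e(1)$ denote the numbers of edges coloured $-1$ and $1$ respectively. -}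

module Defs where

open import Data.Nat using (ℕ; zero; suc; _∸_; _<_; _≤_)
open import Data.Nat.Properties using (_<?_)
open import Data.Fin using (Fin; toℕ)
open import Data.Fin.Properties using ()
open import Data.List using (List; []; _∷_; length; filter; map; concatMap; allFin)
open import Data.Sign using (Sign) renaming (+ to plus; - to minus)
open import Data.Integer using (ℤ; _+_; -_; ∣_∣) renaming (+_ to ⁺)
open import Data.Product using (_×_; _,_; proj₁; proj₂)
open import Relation.Nullary using (Dec; yes; no)
open import Relation.Binary.PropositionalEquality using (_≡_)
import Data.Sign.Properties as SignP
open import Function.Definitions using (Injective)

-- A ±1-colouring of E(K_n), vertices Fin n. The edge {i,j} (i ≠ j) is
-- coloured by  f i j  when toℕ i < toℕ j; values f i j with i ≥ j are irrelevant.
Colouring : ℕ → Set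
Colouring n = Fin n → Fin n → Sign

edgeColour : ∀ {n} → Colouring n → Fin n → Fin n → Sign
edgeColour f i j with toℕ i <? toℕ j
... | yes _ = f i j
... | no _  = f j i

signVal : Sign → ℤ
signVal plus  = ⁺ 1
signVal minus = - (⁺ 1)

edges : (n : ℕ) → List (Fin n × Fin n)
edges n = concatMap (λ i → map (λ j → (i , j)) (filter (λ j → toℕ i <? toℕ j) (allFin n))) (allFin n)

e : ∀ {n} → Colouring n → Sign → ℕ
e {n} f s = length (filter (λ ij → SignP._≟_ (f (proj₁ ij) (proj₂ ij)) s) (edges n))

pathWeight : ∀ {n} → Colouring n → List (Fin n) → ℤ
pathWeight f []            = ⁺ 0
pathWeight f (v ∷ [])      = ⁺ 0
pathWeight f (v ∷ w ∷ vs)  = signVal (edgeColour f v w) + pathWeight f (w ∷ vs)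

-- A spanning (Hamiltonian) path of K_n is given by an injective ordering
-- π : Fin n → Fin n of all vertices; the path is π 0, π 1, …, π (n-1).
record SpanningPath (n : ℕ) : Set where
  field
    order : Fin n → Fin n
    injective : Injective _≡_ _≡_ order

vertices : ∀ {n} → SpanningPath n → List (Fin n)
vertices {n} P = map (SpanningPath.order P) (allFin n)

weight : ∀ {n} → Colouring n → SpanningPath n → ℤ
weight f P = pathWeight f (vertices P)

{-# OPTIONS --safe #-}
module Submission where

-- Write k = ⌊(n−1)/2⌋ = 2s + c + 1 with s = ⌊(n−3)/4⌋. Reversing a prefix of a spanning path
-- replaces one edge, and prefix reversals connect all orderings, so it suffices to find a spanning
-- path with at least k edges of colour −1 and one with at least k edges of colour 1. Each colour
-- class is thus treated separately, as a graph G with more than C(n,2) − C(n−s,2) + c edges.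
--
-- If u, v are non-adjacent in G with deg u + deg v ≥ k and G + uv has a spanning path with k edges
-- in the graph, then so has G (a Bondy–Chvátal closure). Otherwise take non-adjacent u, v with
-- deg u + deg v ≤ k − 1 maximal and deg u ≤ deg v: all non-neighbours of v have degree at most
-- deg u and all non-neighbours of u degree at most deg v, which bounds the number of edges by
-- C(n,2) − C(n−s,2) + c.
--
-- For sharpness, colour with −1 the edges meeting s fixed vertices and, if c = 1, one more edge:
-- a path contains at most 2s + c = k − 1 of them.

open import Defs
open import Data.Nat using (ℕ; zero; suc; _+_; _*_; _∸_; _<_; _≤_; _/_; _%_; z≤n; s≤s; _<ᵇ_; _≤?_; _<?_)
open import Data.Nat.Combinatorics using (_C_; nC1≡n; nCk+nC[k+1]≡[n+1]C[k+1])
open import Data.Sign using (Sign) renaming (+ to plus; - to minus)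
open import Data.Integer using (∣_∣; _⊖_) renaming (_+_ to _+ℤ_)
open import Data.Product using (_×_; _,_; Σ; ∃; ∃₂; proj₁; proj₂)
open import Data.Sum using (_⊎_; inj₁; inj₂)
open import Relation.Nullary using (¬_; Dec; yes; no; does; contradiction)
open import Relation.Binary.PropositionalEquality

import Data.Bool.Properties as Bool
open import Data.Bool using (Bool; true; false; _∧_; _∨_; not; if_then_else_)
open import Data.Bool.Properties using (∨-comm; ∧-comm; ∧-zeroʳ)
open import Data.Fin using (Fin; zero; suc; toℕ; punchOut; punchIn; cast; fromℕ<; _≟_)
open import Data.Fin.Properties using
  (punchIn-punchOut; punchOut-injective; any?; cast-is-id; toℕ-fromℕ<; toℕ-cast; toℕ-injective)
open import Data.Integer.Properties using (distribʳ-⊖-+-pos; distribʳ-⊖-+-neg; ∣⊖∣-≤; ∣m⊖n∣≡∣n⊖m∣)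
open import Data.List using
  (List; []; _∷_; _++_; _∷ʳ_; map; reverse; length; allFin; tabulate; lookup; filter; concatMap)
open import Data.List.Membership.Propositional.Properties using (∈-lookup)
open import Data.List.Properties using
  (map-tabulate; map-∘; length-map; tabulate-lookup; tabulate-cong; length-tabulate; unfold-reverse;
   reverse-++; reverse-involutive; ∷-injectiveʳ; ∷ʳ-++; ++-assoc; filter-++; length-++)
import Data.List.Relation.Binary.Permutation.Propositional as ↭
open ↭ using (_↭_; ↭-refl; ↭-sym; ↭-trans; ↭⇒↭ₛ)
open import Data.List.Relation.Binary.Permutation.Propositional.Properties
  using (map⁺; ++⁺ˡ; ++⁺ʳ; ++-comm; ↭-reverse; ↭-length)
import Data.List.Relation.Binary.Permutation.Setoid.Properties as PermS
import Data.List.Relation.Unary.All as All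
open All using (All; []; _∷_)
open import Data.List.Relation.Unary.Unique.Propositional using (Unique; []; _∷_)
import Data.List.Relation.Unary.Unique.Propositional.Properties as Uniqueₚ
open Uniqueₚ using (allFin⁺)
open import Data.Nat.Divisibility using (n∣m*n)
open import Data.Nat.DivMod using
  (+-distrib-/-∣ʳ; m<n⇒m/n≡0; m*n/n≡m; [m+kn]%n≡m%n; m<n⇒m%n≡m; m<n*o⇒m/o<n; m%n<n; m≡m%n+[m/n]*n; m/n≤m)
open import Data.Nat.ListAction using () renaming (sum to sumᴸ)
open import Data.Nat.ListAction.Properties using (sum-↭)
open import Data.Nat.Properties renaming (_≟_ to _≟ℕ_) hiding (_≤?_; _<?_)
open import Data.Nat.Tactic.RingSolver using (solve-∀)
import Data.Sign.Properties as SignP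
open import Function using (_∘_; id)
open import Function.Definitions using (Injective)
open import Relation.Binary.Construct.Closure.ReflexiveTransitive using (Star; ε; _◅_; _◅◅_)
open import Relation.Binary.Definitions using (tri<; tri≈; tri>)
open import Relation.Nullary.Decidable using (_×-dec_; ¬?; dec-false; dec-true)

open import Algebra.Properties.CommutativeMonoid.Sum +-0-commutativeMonoid
  using (sum; sum-cong-≗; sum-replicate-zero; sum-remove; ∑-distrib-+; ∑-comm)
open import Algebra.Properties.Semiring.Sum +-*-semiring using (*-distribˡ-sum; *-distribʳ-sum)

-- Finite sums

𝟙 : Bool → ℕ
𝟙 b = if b then 1 else 0

𝟙≤1 : ∀ b → 𝟙 b ≤ 1
𝟙≤1 true  = ≤-refl
𝟙≤1 false = z≤n

∑-mono : ∀ {n} {f g : Fin n → ℕ} → (∀ i → f i ≤ g i) → sum f ≤ sum g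
∑-mono {zero}  f≤g = z≤n
∑-mono {suc n} f≤g = +-mono-≤ (f≤g zero) (∑-mono (f≤g ∘ suc))

∑-const : ∀ n c → sum {n} (λ _ → c) ≡ n * c
∑-const zero    c = refl
∑-const (suc n) c = cong (c +_) (∑-const n c)

∑-δ : ∀ {n} (j : Fin n) → sum (λ i → 𝟙 (does (i ≟ j))) ≡ 1
∑-δ {suc n} zero    = cong suc (sum-replicate-zero n)
∑-δ {suc n} (suc j) = ∑-δ j

∑-initial : ∀ {n} s → s ≤ n → sum {n} (λ i → 𝟙 (toℕ i <ᵇ s)) ≡ s
∑-initial {n} zero    _         = sum-replicate-zero n
∑-initial     (suc s) (s≤s s≤n) = cong suc (∑-initial s s≤n)

-- Removing the value `h zero` from the codomain leaves an injection of the remaining indices. The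
-- inequality is enough to bound sums over the vertices of a path, so surjectivity of its ordering
-- never has to be shown.
∑-injective : ∀ {m n} (h : Fin m → Fin n) → Injective _≡_ _≡_ h → (g : Fin n → ℕ) → sum (g ∘ h) ≤ sum g
∑-injective {zero}          h inj g = z≤n
∑-injective {suc m} {zero}  h inj g with () ← h zero
∑-injective {suc m} {suc n} h inj g = begin
  g (h zero) + sum (g ∘ h ∘ suc)               ≡⟨ cong (g (h zero) +_) (sum-cong-≗ (cong g ∘ sym ∘ punchIn-punchOut ∘ h0≢)) ⟩
  g (h zero) + sum (g ∘ punchIn (h zero) ∘ h′) ≤⟨ +-monoʳ-≤ (g (h zero)) (∑-injective h′ h′-injective (g ∘ punchIn (h zero))) ⟩
  g (h zero) + sum (g ∘ punchIn (h zero))      ≡⟨ sum-remove g ⟨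
  sum g                                        ∎
  where
  open ≤-Reasoning
  h0≢ : ∀ i → h zero ≢ h (suc i)
  h0≢ i eq with () ← inj eq
  h′ : Fin m → Fin n
  h′ i = punchOut (h0≢ i)
  h′-injective : Injective _≡_ _≡_ h′
  h′-injective {i} {j} eq with refl ← inj (punchOut-injective (h0≢ i) (h0≢ j) eq) = refl

sumᴸ-tabulate : ∀ {n} (g : Fin n → ℕ) → sumᴸ (tabulate g) ≡ sum g
sumᴸ-tabulate {zero}  g = refl
sumᴸ-tabulate {suc n} g = cong (g zero +_) (sumᴸ-tabulate (g ∘ suc))

sumᴸ-allFin : ∀ {n} (g : Fin n → ℕ) → sumᴸ (map g (allFin n)) ≡ sum g
sumᴸ-allFin g = trans (cong sumᴸ (map-tabulate id g)) (sumᴸ-tabulate g)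

sumᴸ-spanning : ∀ {n} (g : Fin n → ℕ) {l} → l ↭ allFin n → sumᴸ (map g l) ≡ sum g
sumᴸ-spanning g l↭ = trans (sum-↭ (map⁺ g l↭)) (sumᴸ-allFin g)

-- Sums along a path

module _ {A : Set} where

  pathSum : (A → A → ℕ) → List A → ℕ
  pathSum g []          = 0
  pathSum g (x ∷ [])    = 0
  pathSum g (x ∷ y ∷ l) = g x y + pathSum g (y ∷ l)

  pathSum-mono : ∀ {g h} → (∀ x y → g x y ≤ h x y) → ∀ l → pathSum g l ≤ pathSum h l
  pathSum-mono g≤h []          = z≤n
  pathSum-mono g≤h (x ∷ [])    = z≤n
  pathSum-mono g≤h (x ∷ y ∷ l) = +-mono-≤ (g≤h x y) (pathSum-mono g≤h (y ∷ l))

  pathSum-+ : ∀ g h l → pathSum (λ x y → g x y + h x y) l ≡ pathSum g l + pathSum h l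
  pathSum-+ g h []          = refl
  pathSum-+ g h (x ∷ [])    = refl
  pathSum-+ g h (x ∷ y ∷ l) = trans (cong (g x y + h x y +_) (pathSum-+ g h (y ∷ l)))
    (interchange (g x y) (h x y) (pathSum g (y ∷ l)) (pathSum h (y ∷ l)))
    where
    interchange : ∀ a b c d → a + b + (c + d) ≡ a + c + (b + d)
    interchange = solve-∀

  -- The empty list is exceptional: it has no steps, and its length is not one more than that.
  pathSum-1 : ∀ l → suc (pathSum (λ _ _ → 1) l) ≡ length l ⊎ l ≡ []
  pathSum-1 []          = inj₂ refl
  pathSum-1 (x ∷ [])    = inj₁ refl
  pathSum-1 (x ∷ y ∷ l) with pathSum-1 (y ∷ l)
  ... | inj₁ eq = inj₁ (cong suc eq)

  pathSum-join : ∀ g p x y q →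
    pathSum g (p ∷ʳ x ++ y ∷ q) ≡ pathSum g (p ∷ʳ x) + (g x y + pathSum g (y ∷ q))
  pathSum-join g []          x y q = refl
  pathSum-join g (z ∷ [])    x y q = cong (_+ (g x y + pathSum g (y ∷ q))) (sym (+-identityʳ (g z x)))
  pathSum-join g (z ∷ w ∷ p) x y q =
    trans (cong (g z w +_) (pathSum-join g (w ∷ p) x y q)) (sym (+-assoc (g z w) _ _))

  pathSum-reverse : ∀ g → (∀ x y → g x y ≡ g y x) → ∀ l → pathSum g (reverse l) ≡ pathSum g l
  pathSum-reverse g g-sym []          = refl
  pathSum-reverse g g-sym (x ∷ [])    = refl
  pathSum-reverse g g-sym (x ∷ y ∷ l) = begin
    pathSum g (reverse (x ∷ y ∷ l))                 ≡⟨ cong (pathSum g) (trans (unfold-reverse x (y ∷ l)) (cong (_∷ʳ x) (unfold-reverse y l))) ⟩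
    pathSum g (reverse l ∷ʳ y ∷ʳ x)                 ≡⟨ pathSum-join g (reverse l) y x [] ⟩
    pathSum g (reverse l ∷ʳ y) + (g y x + 0)        ≡⟨ cong₂ _+_ (cong (pathSum g) (sym (unfold-reverse y l))) (+-identityʳ (g y x)) ⟩
    pathSum g (reverse (y ∷ l)) + g y x             ≡⟨ cong₂ _+_ (pathSum-reverse g g-sym (y ∷ l)) (g-sym y x) ⟩
    pathSum g (y ∷ l) + g x y                       ≡⟨ +-comm _ (g x y) ⟩
    g x y + pathSum g (y ∷ l)                       ∎
    where open ≡-Reasoning

  -- A strict inequality between two sums is strict in some term. This locates a missing link
  -- (against the constant 1), a profitable exchange, or an occurrence of an added edge (against the
  -- constant 0), and cuts the list there.
  pathSum-split : ∀ {g h} l → pathSum g l < pathSum h l →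
    ∃₂ λ p x → ∃₂ λ y q → l ≡ p ∷ʳ x ++ y ∷ q × g x y < h x y
  pathSum-split {g} {h} (x ∷ y ∷ l) lt with g x y <? h x y | pathSum-split {g} {h} (y ∷ l)
  ... | yes g<h | _ = [] , x , y , l , refl , g<h
  ... | no  g≮h | rec with rec (+-cancelˡ-< (g x y) _ _ (≤-trans lt (+-monoˡ-≤ _ (≮⇒≥ g≮h))))
  ...   | p , x′ , y′ , q , eq , g<h = x ∷ p , x′ , y′ , q , cong (x ∷_) eq , g<h

  pathSum-heads : ∀ (g : A → ℕ) x l → pathSum (λ _ y → g y) (x ∷ l) ≡ sumᴸ (map g l)
  pathSum-heads g x []      = refl
  pathSum-heads g x (y ∷ l) = cong (g y +_) (pathSum-heads g y l)

  pathSum-tails : ∀ (g : A → ℕ) l x → pathSum (λ x _ → g x) (l ∷ʳ x) ≡ sumᴸ (map g l)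
  pathSum-tails g []          x = refl
  pathSum-tails g (y ∷ [])    x = refl
  pathSum-tails g (y ∷ z ∷ l) x = cong (g y +_) (pathSum-tails g (z ∷ l) x)

  pathSum-join′ : ∀ g {P Q p x y q} → P ≡ p ∷ʳ x → Q ≡ y ∷ q →
    pathSum g (P ++ Q) ≡ pathSum g P + (g x y + pathSum g Q)
  pathSum-join′ g {p = p} {x} {y} {q} refl refl = pathSum-join g p x y q

  pathSum-0 : ∀ l → pathSum (λ _ _ → 0) l ≡ 0
  pathSum-0 []          = refl
  pathSum-0 (x ∷ [])    = refl
  pathSum-0 (x ∷ y ∷ l) = pathSum-0 (y ∷ l)

  pathSum-++-≥ : ∀ g p q → pathSum g p + pathSum g q ≤ pathSum g (p ++ q)
  pathSum-++-≥ g []          q       = ≤-refl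
  pathSum-++-≥ g (x ∷ [])    []      = z≤n
  pathSum-++-≥ g (x ∷ [])    (y ∷ q) = m≤n+m _ (g x y)
  pathSum-++-≥ g (x ∷ y ∷ p) q       =
    ≤-trans (≤-reflexive (+-assoc (g x y) _ _)) (+-monoʳ-≤ (g x y) (pathSum-++-≥ g (y ∷ p) q))

  pathSum-++-≤ : ∀ g → (∀ x y → g x y ≤ 1) → ∀ p q → pathSum g (p ++ q) ≤ suc (pathSum g p + pathSum g q)
  pathSum-++-≤ g g≤1 []          q       = n≤1+n _
  pathSum-++-≤ g g≤1 (x ∷ [])    []      = z≤n
  pathSum-++-≤ g g≤1 (x ∷ [])    (y ∷ q) = +-monoˡ-≤ _ (g≤1 x y)
  pathSum-++-≤ g g≤1 (x ∷ y ∷ p) q       = begin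
    g x y + pathSum g (y ∷ p ++ q)                   ≤⟨ +-monoʳ-≤ (g x y) (pathSum-++-≤ g g≤1 (y ∷ p) q) ⟩
    g x y + suc (pathSum g (y ∷ p) + pathSum g q)    ≡⟨ +-suc (g x y) _ ⟩
    suc (g x y + (pathSum g (y ∷ p) + pathSum g q))  ≡⟨ cong suc (+-assoc (g x y) _ _) ⟨
    suc (g x y + pathSum g (y ∷ p) + pathSum g q)    ∎
    where open ≤-Reasoning

  starts-prefix : ∀ (p : List A) {x r v m} → p ∷ʳ x ++ r ≡ v ∷ m → ∃ λ p′ → p ∷ʳ x ≡ v ∷ p′
  starts-prefix []      refl = [] , refl
  starts-prefix (z ∷ p) refl = p ∷ʳ _ , refl

  ends-suffix : ∀ (r : List A) {y q m u} → r ++ y ∷ q ≡ m ∷ʳ u → ∃ λ q′ → y ∷ q ≡ q′ ∷ʳ u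
  ends-suffix []          {m = m}     eq = m , eq
  ends-suffix (z ∷ r)     {m = _ ∷ _} eq = ends-suffix r (∷-injectiveʳ eq)
  ends-suffix (z ∷ [])    {m = []}    ()
  ends-suffix (z ∷ w ∷ r) {m = []}    ()

-- Exchange and closure

record Graph (n : ℕ) : Set where
  field
    adj        : Fin n → Fin n → Bool
    adj-sym    : ∀ x y → adj x y ≡ adj y x
    adj-irrefl : ∀ x → adj x x ≡ false

module _ {n} (G : Graph n) where
  open Graph G

  edge : Fin n → Fin n → ℕ
  edge x y = 𝟙 (adj x y)

  edge-sym : ∀ x y → edge x y ≡ edge y x
  edge-sym x y = cong 𝟙 (adj-sym x y)

  deg : Fin n → ℕ
  deg v = sum (edge v)

  links : List (Fin n) → ℕ
  links = pathSum edge

  links-reverse : ∀ l → links (reverse l) ≡ links l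
  links-reverse = pathSum-reverse edge edge-sym

  Improvable : List (Fin n) → Set
  Improvable l = ∃ λ l′ → l′ ↭ l × links l < links l′

  -- Closes the list to a cycle along the edge v y and opens the cycle at a missing link.
  reopen : ∀ {v m m′ y} l → l ≡ v ∷ m → l ≡ m′ ∷ʳ y → adj v y ≡ true →
    suc (links l) < length l → Improvable l
  reopen {v} {y = y} l starts ends v~y short
    with pathSum-split {g = edge} {λ _ _ → 1} l (missing-link (pathSum-1 l))
    where
    missing-link : suc (pathSum (λ _ _ → 1) l) ≡ length l ⊎ l ≡ [] → links l < pathSum (λ _ _ → 1) l
    missing-link (inj₁ eq)   = ≤-pred (subst (suc (links l) <_) (sym eq) short)
    missing-link (inj₂ l≡[]) = contradiction (trans (sym l≡[]) starts) λ ()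
  ... | p , x , z , q , refl , x≁z
    with p′ , P≡ ← starts-prefix p starts | q′ , Q≡ ← ends-suffix (p ∷ʳ x) ends
    = z ∷ q ++ p ∷ʳ x , ++-comm (z ∷ q) (p ∷ʳ x) , (begin-strict
      links (p ∷ʳ x ++ z ∷ q)                             ≡⟨ pathSum-join edge p x z q ⟩
      links (p ∷ʳ x) + (edge x z + links (z ∷ q))         <⟨ +-monoʳ-< (links (p ∷ʳ x)) (+-monoˡ-< (links (z ∷ q)) x≁z) ⟩
      links (p ∷ʳ x) + (1 + links (z ∷ q))                ≡⟨ rotate (links (p ∷ʳ x)) 1 (links (z ∷ q)) ⟩
      links (z ∷ q) + (1 + links (p ∷ʳ x))                ≡⟨ cong (λ e → links (z ∷ q) + (𝟙 e + links (p ∷ʳ x))) (trans (adj-sym y v) v~y) ⟨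
      links (z ∷ q) + (edge y v + links (p ∷ʳ x))         ≡⟨ pathSum-join′ edge Q≡ P≡ ⟨
      links (z ∷ q ++ p ∷ʳ x)                             ∎)
    where
    open ≤-Reasoning
    rotate : ∀ a b c → a + (b + c) ≡ c + (b + a)
    rotate = solve-∀

  -- Each vertex but the first is the second end of exactly one step, and the first is `v` itself,
  -- which contributes nothing because there are no loops.
  deg-start : ∀ {v m l} → l ≡ v ∷ m → l ↭ allFin n → deg v ≡ pathSum (λ _ y → edge v y) l
  deg-start {v} {m} refl l↭ = begin
    deg v                                    ≡⟨ sumᴸ-spanning (edge v) l↭ ⟨
    edge v v + sumᴸ (map (edge v) m)         ≡⟨ cong (λ e → 𝟙 e + sumᴸ (map (edge v) m)) (adj-irrefl v) ⟩
    sumᴸ (map (edge v) m)                    ≡⟨ pathSum-heads (edge v) v m ⟨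
    pathSum (λ _ y → edge v y) (v ∷ m)       ∎
    where open ≡-Reasoning

  deg-end : ∀ {u m l} → l ≡ m ∷ʳ u → l ↭ allFin n → deg u ≡ pathSum (λ x _ → edge u x) l
  deg-end {u} {m} refl l↭ = begin
    deg u                                    ≡⟨ sumᴸ-spanning (edge u) (↭-trans (++-comm (u ∷ []) m) l↭) ⟨
    edge u u + sumᴸ (map (edge u) m)         ≡⟨ cong (λ e → 𝟙 e + sumᴸ (map (edge u) m)) (adj-irrefl u) ⟩
    sumᴸ (map (edge u) m)                    ≡⟨ pathSum-tails (edge u) m u ⟨
    pathSum (λ x _ → edge u x) (m ∷ʳ u)      ∎
    where open ≡-Reasoning

  -- For a list from v to u, the steps (x , y) with v ~ y or u ~ x are counted by deg v + deg u.
  -- If this exceeds the number of links, some step admits an exchange.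
  exchange : ∀ {v m m′ u} l → l ≡ v ∷ m → l ≡ m′ ∷ʳ u → l ↭ allFin n →
    suc (links l) < n → links l < deg v + deg u → Improvable l
  exchange {v} {m} {m′} {u} l starts ends l↭ short large
    with pathSum-split {g = edge} {λ x y → edge v y + edge u x} l (subst (links l <_) degrees large)
    where
    degrees : deg v + deg u ≡ pathSum (λ x y → edge v y + edge u x) l
    degrees = trans (cong₂ _+_ (deg-start starts l↭) (deg-end ends l↭)) (sym (pathSum-+ (λ _ y → edge v y) (λ x _ → edge u x) l))
  ... | p , x , y , q , refl , gain
    with p′ , P≡ ← starts-prefix p starts | q′ , Q≡ ← ends-suffix (p ∷ʳ x) ends
    = choose (cases (adj v y) (adj u x) (adj x y) gain)
    where
    P = p ∷ʳ x
    Q = y ∷ q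
    P-reversed : reverse P ≡ reverse p′ ∷ʳ v
    P-reversed = trans (cong reverse P≡) (unfold-reverse v p′)
    Q-reversed : reverse Q ≡ u ∷ reverse q′
    Q-reversed = trans (cong reverse Q≡) (reverse-++ q′ (u ∷ []))
    links-prefix : links (reverse P ++ Q) ≡ links P + (edge v y + links Q)
    links-prefix = trans (pathSum-join′ edge P-reversed refl) (cong (_+ (edge v y + links Q)) (links-reverse P))
    links-suffix : links (P ++ reverse Q) ≡ links P + (edge u x + links Q)
    links-suffix = trans (pathSum-join′ edge {P = P} refl Q-reversed)
      (cong₂ (λ a b → links P + (a + b)) (edge-sym x u) (links-reverse Q))
    links-change : ∀ {e} → edge x y < e → links (P ++ Q) < links P + (e + links Q)
    links-change lt = subst (_< links P + (_ + links Q)) (sym (pathSum-join edge p x y q)) (+-monoʳ-< (links P) (+-monoˡ-< (links Q) lt))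
    -- Either the step is a non-edge and one of the two new edges is present, so that reversing one
    -- side gains a link, or all three are edges.
    cases : ∀ a b e → 𝟙 e < 𝟙 a + 𝟙 b → 𝟙 e < 𝟙 a ⊎ 𝟙 e < 𝟙 b ⊎ (a ≡ true × e ≡ b)
    cases true  b     false _         = inj₁ (s≤s z≤n)
    cases false true  false _         = inj₂ (inj₁ (s≤s z≤n))
    cases true  true  true  _         = inj₂ (inj₂ (refl , refl))
    cases true  false true  (s≤s ())
    cases false true  true  (s≤s ())
    choose : _ → Improvable (P ++ Q)
    choose (inj₁ lt) = reverse P ++ Q , ++⁺ʳ Q (↭-reverse P) ,
      subst (links (P ++ Q) <_) (sym links-prefix) (links-change lt)
    choose (inj₂ (inj₁ lt)) = P ++ reverse Q , ++⁺ˡ P (↭-reverse Q) ,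
      subst (links (P ++ Q) <_) (sym links-suffix) (links-change lt)
    -- Trading `x y` for `x u` leaves the number of links unchanged but moves `y` to the end. As `v`
    -- and `y` are adjacent, the new list closes to a cycle.
    choose (inj₂ (inj₂ (v~y , same))) = reopened
      (reopen (P ++ reverse Q) (cong (_++ reverse Q) P≡)
        (trans (cong (P ++_) (unfold-reverse y q)) (sym (++-assoc P (reverse q) (y ∷ [])))) v~y
        (subst₂ (λ a b → suc a < b) (sym unchanged)
          (sym (trans (↭-length (↭-trans flipped l↭)) (length-tabulate {n = n} id))) short))
      where
      flipped : P ++ reverse Q ↭ P ++ Q
      flipped = ++⁺ˡ P (↭-reverse Q)
      unchanged : links (P ++ reverse Q) ≡ links (P ++ Q)
      unchanged = trans links-suffix (trans (cong (λ e → links P + (𝟙 e + links Q)) (sym same))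
        (sym (pathSum-join edge p x y q)))
      reopened : Improvable (P ++ reverse Q) → Improvable (P ++ Q)
      reopened (l′ , l′↭ , lt) = l′ , ↭-trans l′↭ flipped , subst (_< links l′) unchanged lt

-- Adding a single edge to a graph

joins : ∀ {n} → Fin n → Fin n → Fin n → Fin n → Bool
joins u v x y = (does (x ≟ u) ∧ does (y ≟ v)) ∨ (does (x ≟ v) ∧ does (y ≟ u))

joins-view : ∀ {n} {u v x y : Fin n} → joins u v x y ≡ true → (x ≡ u × y ≡ v) ⊎ (x ≡ v × y ≡ u)
joins-view {u = u} {v} {x} {y} eq with x ≟ u | y ≟ v | x ≟ v | y ≟ u
... | yes x≡u | yes y≡v | _       | _       = inj₁ (x≡u , y≡v)
... | yes _   | no _    | yes x≡v | yes y≡u = inj₂ (x≡v , y≡u)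
... | no _    | _       | yes x≡v | yes y≡u = inj₂ (x≡v , y≡u)
... | yes _   | no _    | yes _   | no _    with () ← eq
... | yes _   | no _    | no _    | _       with () ← eq
... | no _    | _       | yes _   | no _    with () ← eq
... | no _    | _       | no _    | _       with () ← eq

joins-sym : ∀ {n} (u v x y : Fin n) → joins u v x y ≡ joins u v y x
joins-sym u v x y = trans (∨-comm (does (x ≟ u) ∧ does (y ≟ v)) _)
  (cong₂ _∨_ (∧-comm (does (x ≟ v)) _) (∧-comm (does (x ≟ u)) _))

joins-irrefl : ∀ {n} {u v : Fin n} → u ≢ v → ∀ x → joins u v x x ≡ false
joins-irrefl {u = u} {v} u≢v x with joins u v x x in eq
... | false = refl
... | true with joins-view {u = u} {v} {x} {x} eq
...   | inj₁ (refl , x≡v) = contradiction x≡v u≢v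
...   | inj₂ (refl , x≡u) = contradiction (sym x≡u) u≢v

pathSum-joins-avoiding : ∀ {n} {u v w : Fin n} → w ≡ u ⊎ w ≡ v → ∀ {l} → All (w ≢_) l →
  pathSum (λ x y → 𝟙 (joins u v x y)) l ≡ 0
pathSum-joins-avoiding w∈ []       = refl
pathSum-joins-avoiding w∈ (_ ∷ []) = refl
pathSum-joins-avoiding {u = u} {v} w∈ {x ∷ y ∷ l} (w≢x ∷ w≢y ∷ w∉l)
  with pathSum-joins-avoiding w∈ (w≢y ∷ w∉l) | joins u v x y in eq
... | rest | false = rest
... | _    | true with joins-view {u = u} {v} {x} {y} eq | w∈
...   | inj₁ (refl , refl) | inj₁ refl = contradiction refl w≢x
...   | inj₁ (refl , refl) | inj₂ refl = contradiction refl w≢y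
...   | inj₂ (refl , refl) | inj₁ refl = contradiction refl w≢y
...   | inj₂ (refl , refl) | inj₂ refl = contradiction refl w≢x

-- Once the edge has been traversed, its first end does not recur in the list, so the edge cannot be
-- used again.
pathSum-joins≤1 : ∀ {n} (u v : Fin n) {l} → Unique l → pathSum (λ x y → 𝟙 (joins u v x y)) l ≤ 1
pathSum-joins≤1 u v []       = z≤n
pathSum-joins≤1 u v (_ ∷ []) = z≤n
pathSum-joins≤1 u v {x ∷ y ∷ l} (x∉ ∷ unique) with joins u v x y in eq
... | false = pathSum-joins≤1 u v unique
... | true  = s≤s (≤-reflexive (pathSum-joins-avoiding (end (joins-view {u = u} {v} {x} {y} eq)) x∉))
  where
  end : (x ≡ u × y ≡ v) ⊎ (x ≡ v × y ≡ u) → x ≡ u ⊎ x ≡ v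
  end (inj₁ (x≡u , _)) = inj₁ x≡u
  end (inj₂ (x≡v , _)) = inj₂ x≡v

addEdge : ∀ {n} {u v : Fin n} → u ≢ v → Graph n → Graph n
addEdge {u = u} {v} u≢v G = record
  { adj        = λ x y → adj x y ∨ joins u v x y
  ; adj-sym    = λ x y → cong₂ _∨_ (adj-sym x y) (joins-sym u v x y)
  ; adj-irrefl = λ x → cong₂ _∨_ (adj-irrefl x) (joins-irrefl u≢v x)
  } where open Graph G

links-addEdge : ∀ {n} {u v : Fin n} (u≢v : u ≢ v) (G : Graph n) l →
  links (addEdge u≢v G) l ≤ links G l + pathSum (λ x y → 𝟙 (joins u v x y)) l
links-addEdge {u = u} {v} u≢v G l = ≤-trans (pathSum-mono (λ x y → 𝟙-∨ (adj x y) (joins u v x y)) l)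
  (≤-reflexive (pathSum-+ (edge G) (λ x y → 𝟙 (joins u v x y)) l))
  where
  open Graph G
  𝟙-∨ : ∀ a b → 𝟙 (a ∨ b) ≤ 𝟙 a + 𝟙 b
  𝟙-∨ true  b = s≤s z≤n
  𝟙-∨ false b = ≤-refl

Unique-spanning : ∀ {n} {l : List (Fin n)} → l ↭ allFin n → Unique l
Unique-spanning {n} l↭ = PermS.Unique-resp-↭ (setoid (Fin n)) (↭⇒↭ₛ (↭-sym l↭)) (allFin⁺ n)

∑deg-addEdge : ∀ {n} {u v : Fin n} (u≢v : u ≢ v) (G : Graph n) → Graph.adj G u v ≡ false →
  sum (deg (addEdge u≢v G)) ≡ sum (deg G) + 2
∑deg-addEdge {n} {u} {v} u≢v G u≁v = begin
  sum (λ x → sum (λ y → 𝟙 (adj x y ∨ joins u v x y)))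
    ≡⟨ sum-cong-≗ (λ x → sum-cong-≗ (disjoint x)) ⟩
  sum (λ x → sum (λ y → edge G x y + (δ u x * δ v y + δ v x * δ u y)))
    ≡⟨ sum-cong-≗ (λ x → ∑-distrib-+ (edge G x) (λ y → δ u x * δ v y + δ v x * δ u y)) ⟩
  sum (λ x → deg G x + sum (λ y → δ u x * δ v y + δ v x * δ u y))
    ≡⟨ sum-cong-≗ (λ x → cong (deg G x +_) (inner x)) ⟩
  sum (λ x → deg G x + (δ u x + δ v x))
    ≡⟨ ∑-distrib-+ (deg G) (λ x → δ u x + δ v x) ⟩
  sum (deg G) + sum (λ x → δ u x + δ v x)
    ≡⟨ cong (sum (deg G) +_) (trans (∑-distrib-+ (δ u) (δ v)) (cong₂ _+_ (∑-δ u) (∑-δ v))) ⟩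
  sum (deg G) + 2 ∎
  where
  open Graph G
  open ≡-Reasoning
  δ : Fin n → Fin n → ℕ
  δ u x = 𝟙 (does (x ≟ u))
  inner : ∀ x → sum (λ y → δ u x * δ v y + δ v x * δ u y) ≡ δ u x + δ v x
  inner x = trans (∑-distrib-+ (λ y → δ u x * δ v y) (λ y → δ v x * δ u y)) (cong₂ _+_ (row u v) (row v u))
    where
    row : ∀ a b → sum (λ y → δ a x * δ b y) ≡ δ a x
    row a b = trans (sym (*-distribˡ-sum (δ a x) (δ b))) (trans (cong (δ a x *_) (∑-δ b)) (*-identityʳ (δ a x)))
  plain : ∀ b → 𝟙 (b ∨ false) ≡ 𝟙 b + 0
  plain true  = refl
  plain false = refl
  -- The indicator of the new edge splits into its two orientations. They do not overlap because
  -- `u ≢ v`, and neither overlaps `G` because `u` and `v` are non-adjacent.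
  disjoint : ∀ x y → 𝟙 (adj x y ∨ joins u v x y) ≡ edge G x y + (δ u x * δ v y + δ v x * δ u y)
  disjoint x y with x ≟ u | y ≟ v | x ≟ v | y ≟ u
  ... | yes refl | yes refl | yes refl | _        = contradiction refl u≢v
  ... | yes refl | yes refl | no _     | _        rewrite u≁v = refl
  ... | yes refl | no _     | yes refl | _        = contradiction refl u≢v
  ... | yes refl | no _     | no _     | _        = plain (adj x y)
  ... | no _     | yes refl | yes refl | yes refl = contradiction refl u≢v
  ... | no _     | no _     | yes refl | yes refl rewrite adj-sym v u | u≁v = refl
  ... | no _     | _        | yes refl | no _     = plain (adj x y)
  ... | no _     | _        | no _     | _        = plain (adj x y)

-- If the path depends on the added edge, cutting it there and swapping the two pieces gives a list
-- whose ends are `u` and `v`. Their degree sum is at least `k`, so `exchange` applies whenever this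
-- list has fewer than `k` links in `G`.
closure : ∀ {n} (G : Graph n) {u v} (u≢v : u ≢ v) → Graph.adj G u v ≡ false →
  ∀ {k} → k < n → k ≤ deg G u + deg G v →
  ∀ {l} → l ↭ allFin n → k ≤ links (addEdge u≢v G) l → ∃ λ l′ → l′ ↭ allFin n × k ≤ links G l′
closure {n} G {u} {v} u≢v u≁v {k} k<n k≤deg {l} l↭ enough with k ≤? links G l
... | yes k≤ = l , l↭ , k≤
-- Fewer than `k` links in `G` but at least `k` in the larger graph: the added edge lies on `l`.
... | no  k≰ with pathSum-split {g = λ _ _ → 0} {λ x y → 𝟙 (joins u v x y)} l used
  where
  used : pathSum (λ _ _ → 0) l < pathSum (λ x y → 𝟙 (joins u v x y)) l
  used = +-cancelˡ-< (links G l) _ _ (begin-strict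
    links G l + pathSum (λ _ _ → 0) l                       ≡⟨ cong (links G l +_) (pathSum-0 l) ⟩
    links G l + 0                                           ≡⟨ +-identityʳ _ ⟩
    links G l                                               <⟨ ≰⇒> k≰ ⟩
    k                                                       ≤⟨ enough ⟩
    links (addEdge u≢v G) l                                 ≤⟨ links-addEdge u≢v G l ⟩
    links G l + pathSum (λ x y → 𝟙 (joins u v x y)) l       ∎)
    where open ≤-Reasoning
... | p , x , y , q , refl , x-y with joins u v x y in x-y-joined
...   | false with () ← x-y
...   | true with k ≤? links G (y ∷ q ++ p ∷ʳ x)
...     | yes k≤ = _ , ↭-trans (++-comm (y ∷ q) (p ∷ʳ x)) l↭ , k≤
...     | no k≰′ = improve (exchange G {m′ = y ∷ q ++ p} (y ∷ q ++ p ∷ʳ x) refl (sym (++-assoc (y ∷ q) p (x ∷ [])))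
                     rotated (≤-<-trans (≰⇒> k≰′) k<n) (<-≤-trans (≰⇒> k≰′) (k≤ends (joins-view {x = x} x-y-joined))))
  where
  rotated : y ∷ q ++ p ∷ʳ x ↭ allFin n
  rotated = ↭-trans (++-comm (y ∷ q) (p ∷ʳ x)) l↭
  k≤ends : (x ≡ u × y ≡ v) ⊎ (x ≡ v × y ≡ u) → k ≤ deg G y + deg G x
  k≤ends (inj₁ (refl , refl)) = subst (k ≤_) (+-comm (deg G u) (deg G v)) k≤deg
  k≤ends (inj₂ (refl , refl)) = k≤deg
  unlinked : (x ≡ u × y ≡ v) ⊎ (x ≡ v × y ≡ u) → edge G x y ≡ 0
  unlinked (inj₁ (refl , refl)) = cong 𝟙 u≁v
  unlinked (inj₂ (refl , refl)) = cong 𝟙 (trans (Graph.adj-sym G v u) u≁v)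
  -- The path uses the added edge only once, so the swap costs at most one link, and a single
  -- improvement restores `k`.
  almost : k ≤ suc (links G (y ∷ q ++ p ∷ʳ x))
  almost = begin
    k                                                     ≤⟨ enough ⟩
    links (addEdge u≢v G) (p ∷ʳ x ++ y ∷ q)               ≤⟨ links-addEdge u≢v G (p ∷ʳ x ++ y ∷ q) ⟩
    links G (p ∷ʳ x ++ y ∷ q) + pathSum (λ x y → 𝟙 (joins u v x y)) (p ∷ʳ x ++ y ∷ q)
      ≤⟨ +-monoʳ-≤ _ (pathSum-joins≤1 u v (Unique-spanning l↭)) ⟩
    links G (p ∷ʳ x ++ y ∷ q) + 1                         ≡⟨ +-comm _ 1 ⟩
    suc (links G (p ∷ʳ x ++ y ∷ q))                       ≡⟨ cong suc (pathSum-join (edge G) p x y q) ⟩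
    suc (links G (p ∷ʳ x) + (edge G x y + links G (y ∷ q)))
      ≡⟨ cong (λ e → suc (links G (p ∷ʳ x) + (e + links G (y ∷ q)))) (unlinked (joins-view {x = x} x-y-joined)) ⟩
    suc (links G (p ∷ʳ x) + links G (y ∷ q))              ≡⟨ cong suc (+-comm (links G (p ∷ʳ x)) _) ⟩
    suc (links G (y ∷ q) + links G (p ∷ʳ x))              ≤⟨ s≤s (pathSum-++-≥ (edge G) (y ∷ q) (p ∷ʳ x)) ⟩
    suc (links G (y ∷ q ++ p ∷ʳ x))                       ∎
    where open ≤-Reasoning
  improve : Improvable G (y ∷ q ++ p ∷ʳ x) → _
  improve (l′ , l′↭ , lt) = l′ , ↭-trans l′↭ rotated , ≤-trans almost lt

-- Degree sums of closed graphs

module _ {n} (G : Graph n) where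
  open Graph G

  NonAdjacent : Fin n → Fin n → Set
  NonAdjacent u v = u ≢ v × adj u v ≡ false

  nonAdjacent-sym : ∀ {u v} → NonAdjacent u v → NonAdjacent v u
  nonAdjacent-sym {u} {v} (u≢v , u≁v) = u≢v ∘ sym , trans (adj-sym v u) u≁v

  _nonAdjacent?_ : ∀ u v → Dec (NonAdjacent u v)
  u nonAdjacent? v = ¬? (u ≟ v) ×-dec (adj u v Bool.≟ false)

  Dominant : Fin n → Fin n → Set
  Dominant u v = NonAdjacent u v × (∀ {u′ v′} → NonAdjacent u′ v′ → deg G u′ + deg G v′ ≤ deg G u + deg G v)

  dominant-sym : ∀ {u v} → Dominant u v → Dominant v u
  dominant-sym {u} {v} (u≁v , max) =
    nonAdjacent-sym u≁v , λ na → ≤-trans (max na) (≤-reflexive (+-comm (deg G u) (deg G v)))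

  -- The upper bound `m` is lowered until some non-adjacent pair attains it; that pair is dominant.
  -- If not even 0 is attained, no non-adjacent pair exists.
  findDominant : ∀ m → (∀ {u v} → NonAdjacent u v → deg G u + deg G v ≤ m) →
    (∀ {u v} → ¬ NonAdjacent u v) ⊎ ∃₂ Dominant
  findDominant m bound with any? (λ u → any? (λ v → u nonAdjacent? v ×-dec (m ≤? deg G u + deg G v)))
  findDominant m       bound | yes (u , v , u≁v , m≤) = inj₂ (u , v , u≁v , λ na → ≤-trans (bound na) m≤)
  findDominant zero    bound | no none = inj₁ λ na → none (_ , _ , na , z≤n)
  findDominant (suc m) bound | no none = findDominant m λ na →
    ≤-pred (≤∧≢⇒< (bound na) λ eq → none (_ , _ , na , ≤-reflexive (sym eq)))

  ∑-edge+δ : ∀ v → sum (λ w → edge G v w + 𝟙 (does (w ≟ v))) ≡ suc (deg G v)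
  ∑-edge+δ v = trans (∑-distrib-+ (edge G v) (λ w → 𝟙 (does (w ≟ v))))
    (trans (cong (deg G v +_) (∑-δ v)) (+-comm (deg G v) 1))

  deg<n : ∀ v → deg G v < n
  deg<n v = begin
    suc (deg G v)                                 ≡⟨ ∑-edge+δ v ⟨
    sum (λ w → edge G v w + 𝟙 (does (w ≟ v)))     ≤⟨ ∑-mono at-most-one ⟩
    sum {n} (λ _ → 1)                             ≡⟨ ∑-const n 1 ⟩
    n * 1                                         ≡⟨ *-identityʳ n ⟩
    n                                             ∎
    where
    open ≤-Reasoning
    at-most-one : ∀ w → edge G v w + 𝟙 (does (w ≟ v)) ≤ 1
    at-most-one w with w ≟ v
    ... | yes refl rewrite adj-irrefl w = ≤-refl
    ... | no _     = ≤-trans (≤-reflexive (+-identityʳ (edge G v w))) (𝟙≤1 (adj v w))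

  ∑deg≤n*n : sum (deg G) ≤ n * n
  ∑deg≤n*n = ≤-trans (∑-mono (<⇒≤ ∘ deg<n)) (≤-reflexive (∑-const n n))

  -- Non-neighbours of v have degree at most d, non-neighbours of u at most d + x, and all
  -- vertices at most n − 1 = d + x + z.
  ∑deg-dominant : ∀ {u v d x z} → Dominant u v → deg G u ≡ d → deg G v ≡ d + x → n ≡ suc (d + x + z) →
    sum (deg G) ≤ n * d + (x * suc (d + x) + z * d)
  ∑deg-dominant {u} {v} {d} {x} {z} (_ , max) du dv n≡ = begin
    sum (deg G)
      ≤⟨ ∑-mono bound ⟩
    sum (λ w → d + (x * β w + z * edge G u w))
      ≡⟨ trans (∑-distrib-+ {n} (λ _ → d) _) (cong (sum {n} (λ _ → d) +_) (∑-distrib-+ (λ w → x * β w) _)) ⟩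
    sum {n} (λ _ → d) + (sum (λ w → x * β w) + sum (λ w → z * edge G u w))
      ≡⟨ cong₂ _+_ (∑-const n d) (cong₂ _+_ (sym (*-distribˡ-sum x β)) (sym (*-distribˡ-sum z (edge G u)))) ⟩
    n * d + (x * sum β + z * deg G u)
      ≡⟨ cong (λ e → n * d + (x * e + z * deg G u)) (∑-edge+δ v) ⟩
    n * d + (x * suc (deg G v) + z * deg G u)
      ≡⟨ cong₂ (λ e f → n * d + (x * suc e + z * f)) dv du ⟩
    n * d + (x * suc (d + x) + z * d) ∎
    where
    open ≤-Reasoning
    -- `β` indicates the closed neighbourhood of `v`. Outside it the degree is at most `d` by
    -- `small`; inside it, `x` is added, and a further `z` at the neighbours of `u`.
    β : Fin n → ℕ
    β w = edge G v w + 𝟙 (does (w ≟ v))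
    all≤ : ∀ w → deg G w ≤ d + x + z
    all≤ w = ≤-pred (subst (deg G w <_) n≡ (deg<n w))
    small : ∀ {w} → NonAdjacent v w → deg G w ≤ d
    small {w} na = subst (deg G w ≤_) du (+-cancelˡ-≤ (deg G v) _ _
      (≤-trans (max na) (≤-reflexive (+-comm (deg G u) (deg G v)))))
    medium : ∀ {w} → adj u w ≡ false → deg G w ≤ d + x
    medium {w} u≁w with u ≟ w
    ... | yes refl = subst (_≤ d + x) (sym du) (m≤m+n d x)
    ... | no u≢w   = subst (deg G w ≤_) dv (+-cancelˡ-≤ (deg G u) _ _ (max (u≢w , u≁w)))
    near : ∀ w {b} → 1 ≤ b → deg G w ≤ d + (x * b + z * edge G u w)
    near w {suc b} _ with adj u w in eq
    ... | false = ≤-trans (medium eq) (+-monoʳ-≤ d (≤-trans (m≤m*n x (suc b)) (m≤m+n _ _)))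
    ... | true  = ≤-trans (all≤ w) (≤-trans (≤-reflexive (+-assoc d x z))
                    (+-monoʳ-≤ d (+-mono-≤ (m≤m*n x (suc b)) (≤-reflexive (sym (*-identityʳ z))))))
    bound : ∀ w → deg G w ≤ d + (x * β w + z * edge G u w)
    bound w with w ≟ v
    ... | yes _  = near w (m≤n+m 1 (edge G v w))
    ... | no w≢v with adj v w in eq
    ...   | true  = near w ≤-refl
    ...   | false = ≤-trans (small (w≢v ∘ sym , eq)) (m≤m+n d _)

-- Here `d` and `d + x` are the degrees of the dominant pair, `j` is `s - d`, and `y` is the excess
-- of `n` over `4 * s + 2 * c + 3`. After adding `d * d + d` to both sides, `x` occurs on the left,
-- for fixed `n`, only in `x * x + x`, so it may be raised to `2 * j + c`.
dominant-estimate : ∀ d j c x y z → suc (d + x + z) ≡ 4 * (d + j) + 2 * c + 3 + y → x ≤ 2 * j + c →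
  let n = suc (d + x + z); s = d + j in
  n * d + (x * suc (d + x) + z * d) + (s * s + s) ≤ 2 * n * s + (c * c + c)
dominant-estimate d j c x y z n≡ x≤ = +-cancelʳ-≤ (d * d + d) _ _ (begin
  n * d + (x * suc (d + x) + z * d) + (s * s + s) + (d * d + d)
    ≡⟨ gather d x z (s * s + s) ⟩
  2 * n * d + (x * x + x) + (s * s + s)
    ≤⟨ +-monoˡ-≤ (s * s + s) (+-monoʳ-≤ (2 * n * d) (+-mono-≤ (*-mono-≤ x≤ x≤) x≤)) ⟩
  2 * n * d + ((2 * j + c) * (2 * j + c) + (2 * j + c)) + (s * s + s)
    -- The added polynomial is exactly the remaining difference of the two sides; it vanishes when
    -- `j = 0`.
    ≤⟨ m≤m+n _ (6 * (d * j) + 3 * (j * j) + 3 * j + 2 * (y * j)) ⟩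
  2 * n * d + ((2 * j + c) * (2 * j + c) + (2 * j + c)) + (s * s + s) + (6 * (d * j) + 3 * (j * j) + 3 * j + 2 * (y * j))
    ≡⟨ cong (λ n → 2 * n * d + ((2 * j + c) * (2 * j + c) + (2 * j + c)) + (s * s + s) + (6 * (d * j) + 3 * (j * j) + 3 * j + 2 * (y * j))) n≡ ⟩
  2 * N * d + ((2 * j + c) * (2 * j + c) + (2 * j + c)) + (s * s + s) + (6 * (d * j) + 3 * (j * j) + 3 * j + 2 * (y * j))
    ≡⟨ slack d j c y ⟩
  2 * N * s + (c * c + c) + (d * d + d)
    ≡⟨ cong (λ n → 2 * n * s + (c * c + c) + (d * d + d)) n≡ ⟨
  2 * n * s + (c * c + c) + (d * d + d) ∎)
  where
  open ≤-Reasoning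
  n = suc (d + x + z)
  s = d + j
  N = 4 * (d + j) + 2 * c + 3 + y
  gather : ∀ d x z S → suc (d + x + z) * d + (x * suc (d + x) + z * d) + S + (d * d + d) ≡
    2 * suc (d + x + z) * d + (x * x + x) + S
  gather = solve-∀
  slack : ∀ d j c y → 2 * (4 * (d + j) + 2 * c + 3 + y) * d + ((2 * j + c) * (2 * j + c) + (2 * j + c))
    + ((d + j) * (d + j) + (d + j)) + (6 * (d * j) + 3 * (j * j) + 3 * j + 2 * (y * j)) ≡
    2 * (4 * (d + j) + 2 * c + 3 + y) * (d + j) + (c * c + c) + (d * d + d)
  slack = solve-∀

unique-step : ∀ {A : Set} (p : List A) {x y q} → Unique (p ∷ʳ x ++ y ∷ q) → x ≢ y
unique-step []      ((x≢y ∷ _) ∷ _) = x≢y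
unique-step (z ∷ p) (_ ∷ unique)    = unique-step p unique

-- In terms of edges, the bound is C(n,2) - C(n-s,2) + c: the degree sum is twice the number of
-- edges, 2C(n,2) - 2C(n-s,2) equals 2ns - s² - s, and c² + c = 2c for `c ≤ 1`.
∑deg-closed : ∀ {n} (G : Graph n) s c → c ≤ 1 → 4 * s + 2 * c + 3 ≤ n →
  ∀ {u v} → Dominant G u v → deg G u + deg G v ≤ 2 * s + c → deg G u ≤ deg G v →
  sum (deg G) + (s * s + s) ≤ 2 * n * s + (c * c + c)
∑deg-closed {n} G s c c≤1 n≥ {u} {v} dom sum≤ du≤dv = ≤-trans
  (+-monoˡ-≤ (s * s + s) (∑deg-dominant G dom refl v≡ n≡))
  (subst₂ (λ n s → n * d + (x * suc (d + x) + z * d) + (s * s + s) ≤ 2 * n * s + (c * c + c)) (sym n≡) s≡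
    (dominant-estimate d j c x y z (trans (sym n≡) (trans (sym y≡) (cong (λ s → 4 * s + 2 * c + 3 + y) (sym s≡)))) x≤))
  where
  d = deg G u
  x = deg G v ∸ d
  z = n ∸ suc (deg G v)
  y = n ∸ (4 * s + 2 * c + 3)
  v≡ : deg G v ≡ d + x
  v≡ = sym (m+[n∸m]≡n du≤dv)
  n≡ : n ≡ suc (d + x + z)
  n≡ = trans (sym (m+[n∸m]≡n (deg<n G v))) (cong (λ e → suc (e + z)) v≡)
  y≡ : 4 * s + 2 * c + 3 + y ≡ n
  y≡ = m+[n∸m]≡n n≥
  2d≤ : 2 * d ≤ 2 * s + c
  2d≤ = ≤-trans (≤-reflexive (cong (d +_) (+-identityʳ d))) (≤-trans (+-monoʳ-≤ d du≤dv) sum≤)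
  -- A parity argument: `2 * d` is even and at most `2 * s + 1`.
  d≤s : d ≤ s
  d≤s = ≮⇒≥ λ s<d → <⇒≱ (s≤s 2d≤) (begin
    suc (2 * s + c)    ≤⟨ s≤s (+-monoʳ-≤ (2 * s) c≤1) ⟩
    suc (2 * s + 1)    ≡⟨ even s ⟩
    2 * suc s          ≤⟨ *-monoʳ-≤ 2 s<d ⟩
    2 * d              ∎)
    where
    open ≤-Reasoning
    even : ∀ s → suc (2 * s + 1) ≡ 2 * suc s
    even = solve-∀
  j = s ∸ d
  s≡ : d + j ≡ s
  s≡ = m+[n∸m]≡n d≤s
  x≤ : x ≤ 2 * j + c
  x≤ = +-cancelˡ-≤ (d + d) _ _ (begin
    d + d + x              ≡⟨ trans (+-assoc d d x) (cong (d +_) (sym v≡)) ⟩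
    d + deg G v            ≤⟨ sum≤ ⟩
    2 * s + c              ≡⟨ cong (λ s → 2 * s + c) s≡ ⟨
    2 * (d + j) + c        ≡⟨ double d j c ⟩
    d + d + (2 * j + c)    ∎)
    where
    open ≤-Reasoning
    double : ∀ d j c → 2 * (d + j) + c ≡ d + d + (2 * j + c)
    double = solve-∀

-- A missing link of `allFin n` would join two vertices that are distinct, because the list has no
-- repetitions, and non-adjacent.
complete-links : ∀ {n} (G : Graph n) → (∀ {u v} → ¬ NonAdjacent G u v) → 0 < n → n ≤ suc (links G (allFin n))
complete-links {suc n} G complete _ with suc n ≤? suc (links G (allFin (suc n))) | pathSum-1 (allFin (suc n))
... | yes n≤ | _ = n≤
... | no n≰ | inj₁ len
  with p , x , y , q , eq , x≁y ← pathSum-split {g = edge G} {λ _ _ → 1} (allFin (suc n))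
         (≤-pred (subst (suc (links G (allFin (suc n))) <_) (sym (trans len (length-tabulate {n = suc n} id))) (≰⇒> n≰)))
  = contradiction (unique-step p (subst Unique eq (allFin⁺ (suc n))) , unlinked (Graph.adj G x y) x≁y) complete
  where
  unlinked : ∀ b → 𝟙 b < 1 → b ≡ false
  unlinked false _       = refl
  unlinked true (s≤s ())

-- With k = 2s + c + 1 this is k + 1 ≤ 2k + 1; it yields k < n.
linear-size : ∀ s c → suc (suc (2 * s + c)) ≤ 4 * s + 2 * c + 3
linear-size s c = ≤-trans (m≤m+n _ (2 * s + c + 1)) (≤-reflexive (split s c))
  where
  split : ∀ s c → suc (suc (2 * s + c)) + (2 * s + c + 1) ≡ 4 * s + 2 * c + 3
  split = solve-∀

-- The special case n > 2 (2 s + c + 1) of the Ning–Wang theorem on linear forests;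
-- m bounds the number of edges that can still be added.
ning-wang : ∀ {n} m (G : Graph n) s c → c ≤ 1 → 4 * s + 2 * c + 3 ≤ n → n * n ≤ m + sum (deg G) →
  2 * n * s + (c * c + c) < sum (deg G) + (s * s + s) →
  ∃ λ l → l ↭ allFin n × suc (2 * s + c) ≤ links G l
ning-wang {n} m G s c c≤1 n≥ room dense
  with any? (λ u → any? (λ v → _nonAdjacent?_ G u v ×-dec (suc (2 * s + c) ≤? deg G u + deg G v)))
-- No room is left: one more edge would push the degree sum beyond `n * n`.
ning-wang {n} zero G s c c≤1 n≥ room dense | yes (u , v , (u≢v , u≁v) , _) =
  contradiction (∑deg≤n*n (addEdge u≢v G)) (<⇒≱ (≤-<-trans room
    (subst (sum (deg G) <_) (sym (∑deg-addEdge u≢v G u≁v)) (m<m+n _ (s≤s z≤n)))))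
-- The added edge keeps the graph dense and raises the degree sum by 2, which covers the decrease of
-- `m`. The path found in the larger graph is brought back by `closure`.
ning-wang {n} (suc m) G s c c≤1 n≥ room dense | yes (u , v , (u≢v , u≁v) , k≤)
  = let _ , l↭ , many = ning-wang m (addEdge u≢v G) s c c≤1 n≥
          (begin
            n * n                                 ≤⟨ room ⟩
            suc m + sum (deg G)                   ≡⟨ +-suc m _ ⟨
            m + suc (sum (deg G))                 ≤⟨ +-monoʳ-≤ m (m<m+n _ (s≤s z≤n)) ⟩
            m + (sum (deg G) + 2)                 ≡⟨ cong (m +_) (∑deg-addEdge u≢v G u≁v) ⟨
            m + sum (deg (addEdge u≢v G))         ∎)
          (<-≤-trans dense (+-monoˡ-≤ (s * s + s)
            (≤-trans (m≤m+n _ 2) (≤-reflexive (sym (∑deg-addEdge u≢v G u≁v))))))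
    in closure G u≢v u≁v (≤-trans (linear-size s c) n≥) k≤ l↭ many
  where open ≤-Reasoning
-- Now `G` is closed: it is complete, or its dominant pair, ordered by degree, contradicts the
-- density through `∑deg-closed`.
ning-wang {n} m G s c c≤1 n≥ room dense | no none
  with findDominant G (2 * s + c) (λ na → ≤-pred (≰⇒> λ k≤ → none (_ , _ , na , k≤)))
... | inj₁ complete = allFin n , ↭-refl ,
  ≤-pred (≤-trans k<n (complete-links G complete (≤-trans (s≤s z≤n) k<n)))
  where
  k<n : suc (suc (2 * s + c)) ≤ n
  k<n = ≤-trans (linear-size s c) n≥
... | inj₂ (u , v , dom) with ≤-total (deg G u) (deg G v) | ≤-pred (≰⇒> λ k≤ → none (u , v , proj₁ dom , k≤))
...   | inj₁ du≤dv | sum≤ = contradiction (∑deg-closed G s c c≤1 n≥ dom sum≤ du≤dv) (<⇒≱ dense)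
...   | inj₂ dv≤du | sum≤ = contradiction (∑deg-closed G s c c≤1 n≥ (dominant-sym G dom)
          (≤-trans (≤-reflexive (+-comm (deg G v) (deg G u))) sum≤) dv≤du) (<⇒≱ dense)

-- Spanning paths from permutations of the vertex list

lookup-injective : ∀ {A : Set} {l : List A} → Unique l → ∀ i j → lookup l i ≡ lookup l j → i ≡ j
lookup-injective (x∉ ∷ _) zero    zero    _  = refl
lookup-injective (x∉ ∷ _) zero    (suc j) eq = contradiction eq (All.lookup x∉ (∈-lookup j))
lookup-injective (x∉ ∷ _) (suc i) zero    eq = contradiction (sym eq) (All.lookup x∉ (∈-lookup i))
lookup-injective (_ ∷ u)  (suc i) (suc j) eq = cong suc (lookup-injective u i j eq)

spanningPath : ∀ {n} {l : List (Fin n)} → l ↭ allFin n → Σ (SpanningPath n) λ P → vertices P ≡ l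
spanningPath {n} {l} l↭ = go (sym (trans (↭-length l↭) (length-tabulate {n = n} id)))
  where
  map-lookup : ∀ {m} (eq : m ≡ length l) → map (lookup l ∘ cast eq) (allFin m) ≡ l
  map-lookup refl = trans (map-tabulate id _)
    (trans (tabulate-cong (cong (lookup l) ∘ cast-is-id refl)) (tabulate-lookup l))
  go : n ≡ length l → _
  go eq = record
    { order     = lookup l ∘ cast eq
    ; injective = λ {i} {j} same → toℕ-injective (trans (sym (toℕ-cast eq i))
        (trans (cong toℕ (lookup-injective (Unique-spanning l↭) _ _ same)) (toℕ-cast eq j)))
    } , map-lookup eq

Unique-vertices : ∀ {n} (P : SpanningPath n) → Unique (vertices P)
Unique-vertices {n} P = Uniqueₚ.map⁺ (SpanningPath.injective P) (allFin⁺ n)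

-- Interpolation between spanning paths

-- Reversing a prefix replaces a single edge of the path.
Flip : ∀ {A : Set} → List A → List A → Set
Flip l l′ = ∃₂ λ p q → l ≡ p ++ q × l′ ≡ reverse p ++ q

Flip⇒↭ : ∀ {A : Set} {l l′ : List A} → Flip l l′ → l′ ↭ l
Flip⇒↭ (p , q , refl , refl) = ++⁺ʳ q (↭-reverse p)

-- An adjacent transposition in the middle of a list is a product of three prefix reversals.
transposition : ∀ {A : Set} (p : List A) x y q → Star Flip (p ++ x ∷ y ∷ q) (p ++ y ∷ x ∷ q)
transposition p x y q =
    (p ++ x ∷ y ∷ [] , q , sym (++-assoc p (x ∷ y ∷ []) q) , sym (cong (_++ q) (reverse-++ p (x ∷ y ∷ []))))
  ◅ (y ∷ x ∷ [] , reverse p ++ q , refl , refl)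
  ◅ (x ∷ y ∷ reverse p , q , refl , (begin
      p ++ y ∷ x ∷ q                          ≡⟨ ++-assoc p (y ∷ x ∷ []) q ⟨
      (p ++ y ∷ x ∷ []) ++ q                  ≡⟨ cong (λ r → (r ++ y ∷ x ∷ []) ++ q) (reverse-involutive p) ⟨
      (reverse (reverse p) ++ y ∷ x ∷ []) ++ q ≡⟨ cong (_++ q) (reverse-++ (x ∷ y ∷ []) (reverse p)) ⟨
      reverse (x ∷ y ∷ reverse p) ++ q        ∎))
  ◅ ε
  where open ≡-Reasoning

-- A prefix reversal below a fixed head is not a prefix reversal of the whole list, so `↭.prep` does
-- not follow by congruence. The common prefix `p` is generalised instead, which leaves only
-- adjacent transpositions to realise.
flips : ∀ {A : Set} {l l′ : List A} → l ↭ l′ → ∀ p → Star Flip (p ++ l) (p ++ l′)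
flips ↭.refl                     p = ε
flips (↭.prep {l} {l′} x l↭)     p = subst₂ (Star Flip) (∷ʳ-++ p x l) (∷ʳ-++ p x l′) (flips l↭ (p ∷ʳ x))
flips (↭.swap {l} {l′} x y l↭)   p = transposition p x y l ◅◅
  subst₂ (Star Flip) (++-assoc p (y ∷ x ∷ []) l) (++-assoc p (y ∷ x ∷ []) l′) (flips l↭ (p ++ y ∷ x ∷ []))
flips (↭.trans l↭ l↭′)           p = flips l↭ p ◅◅ flips l↭′ p

module _ {A : Set} (g : A → A → ℕ) (g-sym : ∀ x y → g x y ≡ g y x) (g≤1 : ∀ x y → g x y ≤ 1) where

  -- Both pieces keep their sums under reversal; only the step at the seam changes, by at most 1.
  pathSum-flip : ∀ {l l′} → Flip l l′ → pathSum g l′ ≤ suc (pathSum g l)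
  pathSum-flip (p , q , refl , refl) = begin
    pathSum g (reverse p ++ q)                     ≤⟨ pathSum-++-≤ g g≤1 (reverse p) q ⟩
    suc (pathSum g (reverse p) + pathSum g q)      ≡⟨ cong (λ a → suc (a + pathSum g q)) (pathSum-reverse g g-sym p) ⟩
    suc (pathSum g p + pathSum g q)                ≤⟨ s≤s (pathSum-++-≥ g p q) ⟩
    suc (pathSum g (p ++ q))                       ∎
    where open ≤-Reasoning

  -- A discrete intermediate value theorem: a sum that rises by at most 1 at each flip cannot jump
  -- over `k`.
  intermediate : ∀ {l l′ k} → Star Flip l l′ → pathSum g l ≤ k → k ≤ pathSum g l′ →
    ∃ λ l″ → l″ ↭ l × pathSum g l″ ≡ k
  intermediate {l} ε ≤k k≤ = l , ↭-refl , ≤-antisym ≤k k≤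
  intermediate {l} {k = k} (_◅_ {j = l₁} step steps) ≤k k≤ with pathSum g l ≟ℕ k | intermediate {l₁} {k = k} steps
  ... | yes ≡k | _   = l , ↭-refl , ≡k
  ... | no ≢k  | rec = let l″ , l″↭ , eq = rec (≤-trans (pathSum-flip step) (≤∧≢⇒< ≤k ≢k)) k≤
                       in l″ , ↭-trans l″↭ (Flip⇒↭ step) , eq

-- Colour classes as graphs

edgeColour-< : ∀ {n} (f : Colouring n) {x y} → toℕ x < toℕ y → edgeColour f x y ≡ f x y
edgeColour-< f {x} {y} x<y with toℕ x <? toℕ y
... | yes _  = refl
... | no x≮y = contradiction x<y x≮y

edgeColour-> : ∀ {n} (f : Colouring n) {x y} → toℕ y < toℕ x → edgeColour f x y ≡ f y x
edgeColour-> f {x} {y} y<x with toℕ x <? toℕ y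
... | yes x<y = contradiction x<y (<⇒≯ y<x)
... | no _    = refl

edgeColour-sym : ∀ {n} (f : Colouring n) x y → edgeColour f x y ≡ edgeColour f y x
edgeColour-sym f x y with <-cmp (toℕ x) (toℕ y)
... | tri< x<y _ _ = trans (edgeColour-< f x<y) (sym (edgeColour-> f x<y))
... | tri> _ _ y<x = trans (edgeColour-> f y<x) (sym (edgeColour-< f y<x))
... | tri≈ _ x≡y _ with refl ← toℕ-injective x≡y = refl

≟-sym : ∀ {n} (x y : Fin n) → does (x ≟ y) ≡ does (y ≟ x)
≟-sym x y with x ≟ y
... | yes x≡y = sym (dec-true (y ≟ x) (sym x≡y))
... | no x≢y  = sym (dec-false (y ≟ x) (x≢y ∘ sym))

module _ {n} (f : Colouring n) where

  coloured : Sign → Fin n → Fin n → Bool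
  coloured s x y = does (edgeColour f x y SignP.≟ s)

  coloured-sym : ∀ s x y → coloured s x y ≡ coloured s y x
  coloured-sym s x y = cong (λ c → does (c SignP.≟ s)) (edgeColour-sym f x y)

  colourSum : Sign → List (Fin n) → ℕ
  colourSum s = pathSum (λ x y → 𝟙 (coloured s x y))

  colourSum-total : ∀ l → colourSum plus l + colourSum minus l ≡ pathSum (λ _ _ → 1) l
  colourSum-total []          = refl
  colourSum-total (x ∷ [])    = refl
  colourSum-total (x ∷ y ∷ l) with edgeColour f x y | colourSum-total (y ∷ l)
  ... | plus  | rest = cong suc rest
  ... | minus | rest = trans (+-suc (colourSum plus (y ∷ l)) _) (cong suc rest)

  pathWeight-⊖ : ∀ l → pathWeight f l ≡ colourSum plus l ⊖ colourSum minus l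
  pathWeight-⊖ []          = refl
  pathWeight-⊖ (x ∷ [])    = refl
  pathWeight-⊖ (x ∷ y ∷ l) with edgeColour f x y | pathWeight-⊖ (y ∷ l)
  ... | plus  | rest = trans (cong (signVal plus +ℤ_) rest)
    (distribʳ-⊖-+-pos 1 (colourSum plus (y ∷ l)) (colourSum minus (y ∷ l)))
  ... | minus | rest = trans (cong (signVal minus +ℤ_) rest)
    (distribʳ-⊖-+-neg 0 (colourSum plus (y ∷ l)) (colourSum minus (y ∷ l)))

  -- On the diagonal `edgeColour` returns the irrelevant value `f x x`, which is masked here to
  -- exclude loops.
  colourGraph : Sign → Graph n
  colourGraph s = record
    { adj        = λ x y → not (does (x ≟ y)) ∧ coloured s x y
    ; adj-sym    = λ x y → cong₂ (λ a b → not a ∧ b) (≟-sym x y) (coloured-sym s x y)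
    ; adj-irrefl = λ x → cong (λ a → not a ∧ coloured s x x) (dec-true (x ≟ x) refl)
    }

  links≤colourSum : ∀ s l → links (colourGraph s) l ≤ colourSum s l
  links≤colourSum s = pathSum-mono λ x y → 𝟙-∧ (not (does (x ≟ y))) (coloured s x y)
    where
    𝟙-∧ : ∀ a b → 𝟙 (a ∧ b) ≤ 𝟙 b
    𝟙-∧ true  b = ≤-refl
    𝟙-∧ false b = z≤n

-- Counting the edges of a colour class

module _ {A B : Set} {ℓ} {P : B → Set ℓ} (P? : ∀ x → Dec (P x)) where

  length-filter-concatMap : (h : A → List B) → ∀ l →
    length (filter P? (concatMap h l)) ≡ sumᴸ (map (λ x → length (filter P? (h x))) l)
  length-filter-concatMap h []      = refl
  length-filter-concatMap h (x ∷ l) = begin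
    length (filter P? (h x ++ concatMap h l))                   ≡⟨ cong length (filter-++ P? (h x) (concatMap h l)) ⟩
    length (filter P? (h x) ++ filter P? (concatMap h l))       ≡⟨ length-++ (filter P? (h x)) ⟩
    length (filter P? (h x)) + length (filter P? (concatMap h l)) ≡⟨ cong (length (filter P? (h x)) +_) (length-filter-concatMap h l) ⟩
    _                                                           ∎
    where open ≡-Reasoning

  length-filter-map-filter : ∀ {ℓ′} {Q : A → Set ℓ′} (Q? : ∀ x → Dec (Q x)) (h : A → B) → ∀ l →
    length (filter P? (map h (filter Q? l))) ≡ sumᴸ (map (λ x → 𝟙 (does (Q? x) ∧ does (P? (h x)))) l)
  length-filter-map-filter Q? h []      = refl
  length-filter-map-filter Q? h (x ∷ l) with does (Q? x)
  ... | false = length-filter-map-filter Q? h l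
  ... | true with does (P? (h x))
  ...   | false = length-filter-map-filter Q? h l
  ...   | true  = cong suc (length-filter-map-filter Q? h l)

-- `e` counts pairs with increasing ends. The adjacency matrix is that triangular matrix `U` plus
-- its transpose, and both have the same total.
handshake : ∀ {n} (f : Colouring n) s → sum (deg (colourGraph f s)) ≡ 2 * e f s
handshake {n} f s = begin
  sum (λ x → sum (edge (colourGraph f s) x))
    ≡⟨ sum-cong-≗ (λ x → sum-cong-≗ (oriented x)) ⟩
  sum (λ x → sum (λ y → U x y + U y x))
    ≡⟨ sum-cong-≗ (λ x → ∑-distrib-+ (U x) (λ y → U y x)) ⟩
  sum (λ x → sum (U x) + sum (λ y → U y x))
    ≡⟨ ∑-distrib-+ (λ x → sum (U x)) _ ⟩
  sum (λ x → sum (U x)) + sum (λ x → sum (λ y → U y x))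
    ≡⟨ cong₂ _+_ (sym e-∑) (trans (∑-comm (λ x y → U y x)) (sym e-∑)) ⟩
  e f s + e f s
    ≡⟨ cong (e f s +_) (+-identityʳ (e f s)) ⟨
  2 * e f s ∎
  where
  open ≡-Reasoning
  U : Fin n → Fin n → ℕ
  U x y = 𝟙 (does (toℕ x <? toℕ y) ∧ does (f x y SignP.≟ s))
  e-∑ : e f s ≡ sum (λ x → sum (U x))
  e-∑ = begin
    e f s
      ≡⟨ length-filter-concatMap (λ ij → f (proj₁ ij) (proj₂ ij) SignP.≟ s)
           (λ i → map (i ,_) (filter (λ j → toℕ i <? toℕ j) (allFin n))) (allFin n) ⟩
    _ ≡⟨ sumᴸ-allFin (λ i → length (filter (λ ij → f (proj₁ ij) (proj₂ ij) SignP.≟ s)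
           (map (i ,_) (filter (λ j → toℕ i <? toℕ j) (allFin n))))) ⟩
    _ ≡⟨ sum-cong-≗ (λ i → trans
           (length-filter-map-filter (λ ij → f (proj₁ ij) (proj₂ ij) SignP.≟ s) (λ j → toℕ i <? toℕ j) (i ,_) (allFin n))
           (sumᴸ-allFin (U i))) ⟩
    sum (λ x → sum (U x)) ∎
  U-< : ∀ {x y} → toℕ x < toℕ y → U x y ≡ 𝟙 (does (f x y SignP.≟ s))
  U-< {x} {y} x<y = cong (λ b → 𝟙 (b ∧ does (f x y SignP.≟ s))) (dec-true (toℕ x <? toℕ y) x<y)
  U-≮ : ∀ {x y} → ¬ toℕ x < toℕ y → U x y ≡ 0
  U-≮ {x} {y} x≮y = cong (λ b → 𝟙 (b ∧ does (f x y SignP.≟ s))) (dec-false (toℕ x <? toℕ y) x≮y)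
  edge-≢ : ∀ {x y c} → toℕ x ≢ toℕ y → edgeColour f x y ≡ c → edge (colourGraph f s) x y ≡ 𝟙 (does (c SignP.≟ s))
  edge-≢ {x} {y} x≢y refl =
    cong (λ b → 𝟙 (not b ∧ coloured f s x y)) (dec-false (x ≟ y) (x≢y ∘ cong toℕ))
  oriented : ∀ x y → edge (colourGraph f s) x y ≡ U x y + U y x
  oriented x y with <-cmp (toℕ x) (toℕ y)
  ... | tri< x<y x≢y y≮x = trans (edge-≢ x≢y (edgeColour-< f x<y))
          (trans (sym (+-identityʳ _)) (sym (cong₂ _+_ (U-< x<y) (U-≮ y≮x))))
  ... | tri> x≮y x≢y y<x = trans (edge-≢ x≢y (edgeColour-> f y<x)) (sym (cong₂ _+_ (U-≮ x≮y) (U-< y<x)))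
  ... | tri≈ x≮y x≡y y≮x with refl ← toℕ-injective x≡y =
          trans (cong 𝟙 (Graph.adj-irrefl (colourGraph f s) x)) (sym (cong₂ _+_ (U-≮ x≮y) (U-≮ y≮x)))

-- Each of the `n * n` cells is a minus edge, a plus edge or on the diagonal.
e-total : ∀ {n} (f : Colouring n) → 2 * e f minus + 2 * e f plus + n ≡ n * n
e-total {n} f = begin
  2 * e f minus + 2 * e f plus + n
    ≡⟨ cong₂ _+_ (cong₂ _+_ (handshake f minus) (handshake f plus)) (trans (∑-const n 1) (*-identityʳ n)) ⟨
  sum (deg M) + sum (deg P) + sum {n} (λ _ → 1)
    ≡⟨ cong (_+ sum {n} (λ _ → 1)) (∑-distrib-+ (deg M) (deg P)) ⟨
  sum (λ x → deg M x + deg P x) + sum {n} (λ _ → 1)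
    ≡⟨ ∑-distrib-+ (λ x → deg M x + deg P x) (λ _ → 1) ⟨
  sum (λ x → deg M x + deg P x + 1)
    ≡⟨ sum-cong-≗ row ⟩
  sum {n} (λ _ → n)
    ≡⟨ ∑-const n n ⟩
  n * n ∎
  where
  open ≡-Reasoning
  M = colourGraph f minus
  P = colourGraph f plus
  cell : ∀ x y → edge M x y + edge P x y + 𝟙 (does (y ≟ x)) ≡ 1
  cell x y with x ≟ y | edgeColour f x y
  ... | yes refl | _     = cong 𝟙 (dec-true (x ≟ x) refl)
  ... | no x≢y   | plus  = cong (λ b → suc (𝟙 b)) (dec-false (y ≟ x) (x≢y ∘ sym))
  ... | no x≢y   | minus = cong (λ b → suc (𝟙 b)) (dec-false (y ≟ x) (x≢y ∘ sym))
  row : ∀ x → deg M x + deg P x + 1 ≡ n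
  row x = begin
    deg M x + deg P x + 1
      ≡⟨ cong₂ _+_ (∑-distrib-+ (edge M x) (edge P x)) (∑-δ x) ⟨
    sum (λ y → edge M x y + edge P x y) + sum (λ y → 𝟙 (does (y ≟ x)))
      ≡⟨ ∑-distrib-+ (λ y → edge M x y + edge P x y) (λ y → 𝟙 (does (y ≟ x))) ⟨
    sum (λ y → edge M x y + edge P x y + 𝟙 (does (y ≟ x)))
      ≡⟨ sum-cong-≗ (cell x) ⟩
    sum {n} (λ _ → 1)
      ≡⟨ trans (∑-const n 1) (*-identityʳ n) ⟩
    n ∎

-- The degree sum ∑ deg G of a graph whose number of edges is the threshold C(n,2) − C(n−s,2) + c.
Threshold : ℕ → ℕ → ℕ → ℕ → Set
Threshold n s c D = D + (s * s + s) ≡ 2 * n * s + 2 * c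

-- From two dense colour classes to a balanced path

∣⊖∣≤1 : ∀ {a b} → a ≤ suc b → b ≤ suc a → ∣ a ⊖ b ∣ ≤ 1
∣⊖∣≤1 {a} {b} a≤ b≤ with ≤-total a b
... | inj₁ a≤b = subst (_≤ 1) (sym (∣⊖∣-≤ a≤b)) (m≤n+o⇒m∸n≤o b a (≤-trans b≤ (≤-reflexive (+-comm 1 a))))
... | inj₂ b≤a = subst (_≤ 1) (sym (trans (∣m⊖n∣≡∣n⊖m∣ a b) (∣⊖∣-≤ b≤a))) (m≤n+o⇒m∸n≤o a b (≤-trans a≤ (≤-reflexive (+-comm 1 b))))

∣⊖∣≤1⇒≤ : ∀ {a b} → ∣ a ⊖ b ∣ ≤ 1 → a ≤ suc b
∣⊖∣≤1⇒≤ {a} {b} le with ≤-total a b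
... | inj₁ a≤b = m≤n⇒m≤1+n a≤b
... | inj₂ b≤a = begin
  a              ≤⟨ m≤n+m∸n a b ⟩
  b + (a ∸ b)    ≤⟨ +-monoʳ-≤ b (subst (_≤ 1) (trans (∣m⊖n∣≡∣n⊖m∣ a b) (∣⊖∣-≤ b≤a)) le) ⟩
  b + 1          ≡⟨ +-comm b 1 ⟩
  suc b          ∎
  where open ≤-Reasoning

pathSum-total : ∀ {n} (l : List (Fin n)) → 0 < n → length l ≡ n → suc (pathSum (λ _ _ → 1) l) ≡ n
pathSum-total l 0<n len with pathSum-1 l
... | inj₁ eq   = trans eq len
... | inj₂ refl = contradiction len (<⇒≢ 0<n)

-- A spanning path has n - 1 = 2k + r edges with `r ≤ 1`, so it is balanced as soon as its number of
-- minus edges lies between `k` and `k + r`.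
balanced-path : ∀ {n} (f : Colouring n) s c r → c ≤ 1 → r ≤ 1 → n ≡ 4 * s + 2 * c + 3 + r →
  2 * n * s + 2 * c < 2 * e f minus + (s * s + s) → 2 * n * s + 2 * c < 2 * e f plus + (s * s + s) →
  Σ (SpanningPath n) λ P → ∣ weight f P ∣ ≤ 1
balanced-path {n} f s c r c≤1 r≤1 n≡ many⁻ many⁺ = go (half minus many⁻) (half plus many⁺)
  where
  open ≤-Reasoning
  k = suc (2 * s + c)
  k+k+r : n ≡ suc (k + (k + r))
  k+k+r = trans n≡ (halves s c r)
    where
    halves : ∀ s c r → 4 * s + 2 * c + 3 + r ≡ suc (suc (2 * s + c) + (suc (2 * s + c) + r))
    halves = solve-∀
  -- Reconciles the term of the degree estimate with that of the edge threshold.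
  c*c+c : ∀ {c} → c ≤ 1 → c * c + c ≡ 2 * c
  c*c+c z≤n       = refl
  c*c+c (s≤s z≤n) = refl
  half : ∀ t → 2 * n * s + 2 * c < 2 * e f t + (s * s + s) → ∃ λ l → l ↭ allFin n × k ≤ colourSum f t l
  half t many =
    let l , l↭ , k≤ = ning-wang (n * n) (colourGraph f t) s c c≤1
          (≤-trans (m≤m+n _ r) (≤-reflexive (sym n≡))) (m≤m+n _ _)
          (subst₂ (λ a b → 2 * n * s + a < b + (s * s + s)) (sym (c*c+c c≤1)) (sym (handshake f t)) many)
    in l , l↭ , ≤-trans k≤ (links≤colourSum f t l)
  total : ∀ {l} → l ↭ allFin n → colourSum f plus l + colourSum f minus l ≡ k + (k + r)
  total {l} l↭ = trans (colourSum-total f l) (suc-injective (trans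
    (pathSum-total l (subst (0 <_) (sym k+k+r) (s≤s z≤n)) (trans (↭-length l↭) (length-tabulate {n = n} id))) k+k+r))
  k+r≤ : k + r ≤ suc k
  k+r≤ = ≤-trans (+-monoʳ-≤ k r≤1) (≤-reflexive (+-comm k 1))
  finish : ∀ {l} → l ↭ allFin n → k ≤ colourSum f minus l → colourSum f minus l ≤ k + r →
    Σ (SpanningPath n) λ P → ∣ weight f P ∣ ≤ 1
  finish {l} l↭ k≤ ≤k+r = let P , P≡ = spanningPath l↭ in
    P , subst (λ l → ∣ pathWeight f l ∣ ≤ 1) (sym P≡) (subst (λ w → ∣ w ∣ ≤ 1) (sym (pathWeight-⊖ f l))
      (∣⊖∣≤1
        (≤-trans (+-cancelˡ-≤ k _ _ (begin
          k + p          ≡⟨ +-comm k p ⟩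
          p + k          ≤⟨ +-monoʳ-≤ p k≤ ⟩
          p + m          ≡⟨ total l↭ ⟩
          k + (k + r)    ∎)) (≤-trans k+r≤ (s≤s k≤)))
        (≤-trans ≤k+r (≤-trans k+r≤ (s≤s (+-cancelʳ-≤ (k + r) _ _ (begin
          k + (k + r)    ≡⟨ total l↭ ⟨
          p + m          ≤⟨ +-monoʳ-≤ p ≤k+r ⟩
          p + (k + r)    ∎)))))))
    where
    p = colourSum f plus l
    m = colourSum f minus l
  go : (∃ λ l → l ↭ allFin n × k ≤ colourSum f minus l) → (∃ λ l → l ↭ allFin n × k ≤ colourSum f plus l) →
    Σ (SpanningPath n) λ P → ∣ weight f P ∣ ≤ 1
  -- At least `k` plus edges on `l⁺` leave at most `k + r` minus edges. If these are fewer than `k`,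
  -- flipping towards `l⁻` passes a path with exactly `k`.
  go (l⁻ , l⁻↭ , k≤⁻) (l⁺ , l⁺↭ , k≤⁺) with k ≤? colourSum f minus l⁺
  ... | yes k≤ = finish l⁺↭ k≤ (+-cancelˡ-≤ k _ _ (begin
    k + colourSum f minus l⁺                       ≤⟨ +-monoˡ-≤ _ k≤⁺ ⟩
    colourSum f plus l⁺ + colourSum f minus l⁺     ≡⟨ total l⁺↭ ⟩
    k + (k + r)                                    ∎))
  ... | no k≰ =
    let l , l↭ , m≡k = intermediate (λ x y → 𝟙 (coloured f minus x y))
          (λ x y → cong 𝟙 (coloured-sym f minus x y)) (λ x y → 𝟙≤1 (coloured f minus x y))
          (flips (↭-trans l⁺↭ (↭-sym l⁻↭)) []) (<⇒≤ (≰⇒> k≰)) k≤⁻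
    in finish (↭-trans l↭ l⁺↭) (≤-reflexive (sym m≡k)) (≤-trans (≤-reflexive m≡k) (m≤m+n k r))

-- The extremal colouring

pathSum-heads≤ : ∀ {A : Set} (g : A → ℕ) l → pathSum (λ _ y → g y) l ≤ sumᴸ (map g l)
pathSum-heads≤ g []      = z≤n
pathSum-heads≤ g (x ∷ l) = ≤-trans (≤-reflexive (pathSum-heads g x l)) (m≤n+m _ (g x))

pathSum-tails≤ : ∀ {A : Set} (g : A → ℕ) l → pathSum (λ x _ → g x) l ≤ sumᴸ (map g l)
pathSum-tails≤ g []          = z≤n
pathSum-tails≤ g (x ∷ [])    = z≤n
pathSum-tails≤ g (x ∷ y ∷ l) = +-monoʳ-≤ (g x) (pathSum-tails≤ g (y ∷ l))

module _ {n : ℕ} (s : ℕ) where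

  low : Fin n → Bool
  low x = toℕ x <ᵇ s

  coreGraph : Graph n
  coreGraph = record
    { adj        = λ x y → not (does (x ≟ y)) ∧ (low x ∨ low y)
    ; adj-sym    = λ x y → cong₂ (λ a b → not a ∧ b) (≟-sym x y) (∨-comm (low x) (low y))
    ; adj-irrefl = λ x → cong (λ a → not a ∧ (low x ∨ low x)) (dec-true (x ≟ x) refl)
    }

  private
    L : Fin n → ℕ
    L x = 𝟙 (low x)

  ∑deg-core : s ≤ n → Threshold n s 0 (sum (deg coreGraph))
  ∑deg-core s≤n = begin
    sum (deg coreGraph) + (s * s + s)
      ≡⟨ cong (λ a → sum (deg coreGraph) + (s * s + a)) (*-identityʳ s) ⟨
    sum (deg coreGraph) + (s * s + s * 1)
      ≡⟨ cong (λ a → sum (deg coreGraph) + (a * s + a * 1)) ∑L ⟨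
    sum (deg coreGraph) + (sum L * s + sum L * 1)
      ≡⟨ cong (sum (deg coreGraph) +_) (cong₂ _+_ (*-distribʳ-sum s L) (*-distribʳ-sum 1 L)) ⟩
    sum (deg coreGraph) + (sum (λ x → L x * s) + sum (λ x → L x * 1))
      ≡⟨ cong (sum (deg coreGraph) +_) (∑-distrib-+ (λ x → L x * s) _) ⟨
    sum (deg coreGraph) + sum (λ x → L x * s + L x * 1)
      ≡⟨ ∑-distrib-+ (deg coreGraph) _ ⟨
    sum (λ x → deg coreGraph x + (L x * s + L x * 1))
      ≡⟨ sum-cong-≗ row ⟩
    sum (λ x → n * L x + s)
      ≡⟨ trans (∑-distrib-+ (λ x → n * L x) _) (cong₂ _+_ (sym (*-distribˡ-sum n L)) (∑-const n s)) ⟩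
    n * sum L + n * s
      ≡⟨ cong (λ a → n * a + n * s) ∑L ⟩
    n * s + n * s
      ≡⟨ double n s ⟩
    2 * n * s + 0 ∎
    where
    open ≡-Reasoning
    ∑L : sum L ≡ s
    ∑L = ∑-initial s s≤n
    double : ∀ n s → n * s + n * s ≡ 2 * n * s + 0
    double = solve-∀
    -- Inclusion-exclusion: `L x + L y` counts a pair of low vertices twice and also counts the
    -- diagonal. Summing the corrections over all cells gives `s * s + s`.
    cell : ∀ x y → edge coreGraph x y + (L x * L y + L x * 𝟙 (does (y ≟ x))) ≡ L x + L y
    cell x y with x ≟ y | y ≟ x | low x in eqx | low y in eqy
    ... | yes refl | no y≢x   | _     | _     = contradiction refl y≢x
    ... | no x≢y   | yes refl | _     | _     = contradiction refl x≢y
    ... | no _     | no _     | true  | true  = refl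
    ... | no _     | no _     | true  | false = refl
    ... | no _     | no _     | false | true  = refl
    ... | no _     | no _     | false | false = refl
    ... | yes refl | yes _    | true  | true  = refl
    ... | yes refl | yes _    | false | false = refl
    ... | yes refl | yes _    | true  | false with () ← trans (sym eqx) eqy
    ... | yes refl | yes _    | false | true  with () ← trans (sym eqx) eqy
    row : ∀ x → deg coreGraph x + (L x * s + L x * 1) ≡ n * L x + s
    row x = begin
      deg coreGraph x + (L x * s + L x * 1)
        ≡⟨ cong₂ (λ a b → deg coreGraph x + (L x * a + L x * b)) ∑L (∑-δ x) ⟨
      deg coreGraph x + (L x * sum L + L x * sum (λ y → 𝟙 (does (y ≟ x))))
        ≡⟨ cong (deg coreGraph x +_) (cong₂ _+_ (*-distribˡ-sum (L x) L) (*-distribˡ-sum (L x) (λ y → 𝟙 (does (y ≟ x))))) ⟩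
      deg coreGraph x + (sum (λ y → L x * L y) + sum (λ y → L x * 𝟙 (does (y ≟ x))))
        ≡⟨ cong (deg coreGraph x +_) (∑-distrib-+ (λ y → L x * L y) _) ⟨
      deg coreGraph x + sum (λ y → L x * L y + L x * 𝟙 (does (y ≟ x)))
        ≡⟨ ∑-distrib-+ (edge coreGraph x) _ ⟨
      sum (λ y → edge coreGraph x y + (L x * L y + L x * 𝟙 (does (y ≟ x))))
        ≡⟨ sum-cong-≗ (cell x) ⟩
      sum (λ y → L x + L y)
        ≡⟨ trans (∑-distrib-+ {n} (λ _ → L x) L) (cong₂ _+_ (∑-const n (L x)) ∑L) ⟩
      n * L x + s ∎

  -- Every edge has a low end, and each of the `s` low vertices is the first end of at most one step
  -- and the second end of at most one.
  links-core : s ≤ n → (P : SpanningPath n) → links coreGraph (vertices P) ≤ 2 * s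
  links-core s≤n P = begin
    links coreGraph (vertices P)
      ≤⟨ pathSum-mono (λ x y → 𝟙≤ (not (does (x ≟ y))) (low x) (low y)) (vertices P) ⟩
    pathSum (λ x y → L x + L y) (vertices P)
      ≡⟨ pathSum-+ (λ x _ → L x) (λ _ y → L y) (vertices P) ⟩
    pathSum (λ x _ → L x) (vertices P) + pathSum (λ _ y → L y) (vertices P)
      ≤⟨ +-mono-≤ (≤-trans (pathSum-tails≤ L (vertices P)) vertices≤)
                  (≤-trans (pathSum-heads≤ L (vertices P)) vertices≤) ⟩
    s + s
      ≡⟨ cong (s +_) (+-identityʳ s) ⟨
    2 * s ∎
    where
    open ≤-Reasoning
    open SpanningPath P
    vertices≤ : sumᴸ (map L (vertices P)) ≤ s
    vertices≤ = begin
      sumᴸ (map L (map order (allFin n)))    ≡⟨ cong sumᴸ (map-∘ {g = L} {order} (allFin n)) ⟨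
      sumᴸ (map (L ∘ order) (allFin n))      ≡⟨ sumᴸ-allFin (L ∘ order) ⟩
      sum (L ∘ order)                        ≤⟨ ∑-injective order injective L ⟩
      sum L                                  ≡⟨ ∑-initial s s≤n ⟩
      s                                      ∎
    𝟙≤ : ∀ a b c → 𝟙 (a ∧ (b ∨ c)) ≤ 𝟙 b + 𝟙 c
    𝟙≤ false b     c = z≤n
    𝟙≤ true  true  c = s≤s z≤n
    𝟙≤ true  false c = ≤-refl

extremal : ∀ {n} s c → c ≤ 1 → 4 * s + 2 * c + 3 ≤ n →
  Σ (Graph n) λ G → Threshold n s c (sum (deg G)) × (∀ P → links G (vertices P) ≤ 2 * s + c)
extremal {n} s zero _ n≥ = coreGraph s , ∑deg-core s s≤n ,
  λ P → ≤-trans (links-core s s≤n P) (m≤m+n _ 0)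
  where
  s≤n : s ≤ n
  s≤n = ≤-trans (≤-trans (m≤m+n s _) (≤-reflexive (split s))) n≥
    where
    split : ∀ s → s + (3 * s + 3) ≡ 4 * s + 2 * 0 + 3
    split = solve-∀
extremal {n} s (suc zero) _ n≥ = addEdge a≢b K , threshold′ , links≤
  where
  open ≤-Reasoning
  s+1<n : suc s < n
  s+1<n = ≤-trans (≤-trans (m≤m+n _ _) (≤-reflexive (split s))) n≥
    where
    split : ∀ s → suc (suc s) + (3 * s + 3) ≡ 4 * s + 2 * 1 + 3
    split = solve-∀
  s<n : s < n
  s<n = <-trans (n<1+n s) s+1<n
  K = coreGraph {n} s
  -- The vertices numbered `s` and `s + 1` are the first two that are not low, hence non-adjacent in
  -- the core graph.
  a b : Fin n
  a = fromℕ< s<n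
  b = fromℕ< s+1<n
  a≢b : a ≢ b
  a≢b eq = <⇒≢ (n<1+n s) (trans (sym (toℕ-fromℕ< s<n)) (trans (cong toℕ eq) (toℕ-fromℕ< s+1<n)))
  not-low : ∀ {x : Fin n} {m} → toℕ x ≡ m → s ≤ m → low s x ≡ false
  not-low {x} refl s≤x = dec-false (toℕ x <? s) (≤⇒≯ s≤x)
  a≁b : Graph.adj K a b ≡ false
  a≁b = trans (cong₂ (λ l l′ → not (does (a ≟ b)) ∧ (l ∨ l′))
      (not-low (toℕ-fromℕ< s<n) ≤-refl) (not-low (toℕ-fromℕ< s+1<n) (n≤1+n s)))
    (∧-zeroʳ (not (does (a ≟ b))))
  threshold′ : Threshold n s 1 (sum (deg (addEdge a≢b K)))
  threshold′ = begin-equality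
    sum (deg (addEdge a≢b K)) + (s * s + s)    ≡⟨ cong (_+ (s * s + s)) (∑deg-addEdge a≢b K a≁b) ⟩
    sum (deg K) + 2 + (s * s + s)              ≡⟨ shuffle (sum (deg K)) 2 (s * s + s) ⟩
    sum (deg K) + (s * s + s) + 2              ≡⟨ cong (_+ 2) (∑deg-core s (<⇒≤ s<n)) ⟩
    2 * n * s + 0 + 2                                      ≡⟨ +-assoc (2 * n * s) 0 2 ⟩
    2 * n * s + 2                                          ∎
    where
    shuffle : ∀ a b c → a + b + c ≡ a + c + b
    shuffle = solve-∀
  links≤ : ∀ P → links (addEdge a≢b K) (vertices P) ≤ 2 * s + 1
  links≤ P = begin
    links (addEdge a≢b K) (vertices P)
      ≤⟨ links-addEdge a≢b K (vertices P) ⟩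
    links K (vertices P) + pathSum (λ x y → 𝟙 (joins a b x y)) (vertices P)
      ≤⟨ +-mono-≤ (links-core s (<⇒≤ s<n) P) (pathSum-joins≤1 a b (Unique-vertices P)) ⟩
    2 * s + 1 ∎
extremal s (suc (suc c)) (s≤s ()) n≥

module _ {n} (G : Graph n) where
  open Graph G

  colouring : Colouring n
  colouring x y = if adj x y then minus else plus

  edgeColour-colouring : ∀ x y → edgeColour colouring x y ≡ colouring x y
  edgeColour-colouring x y with toℕ x <? toℕ y
  ... | yes _ = refl
  ... | no  _ = cong (if_then minus else plus) (adj-sym y x)

  coloured-colouring : ∀ x y → coloured colouring minus x y ≡ adj x y
  coloured-colouring x y = trans (cong (λ t → does (t SignP.≟ minus)) (edgeColour-colouring x y)) (lemma (adj x y))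
    where
    lemma : ∀ b → does ((if b then minus else plus) SignP.≟ minus) ≡ b
    lemma true  = refl
    lemma false = refl

  2e-colouring : 2 * e colouring minus ≡ sum (deg G)
  2e-colouring = trans (sym (handshake colouring minus)) (sum-cong-≗ λ x → sum-cong-≗ λ y → cong 𝟙 (same x y))
    where
    same : ∀ x y → not (does (x ≟ y)) ∧ coloured colouring minus x y ≡ adj x y
    same x y with x ≟ y
    ... | yes refl = sym (adj-irrefl x)
    ... | no _     = coloured-colouring x y

  colourSum-colouring : ∀ l → colourSum colouring minus l ≤ links G l
  colourSum-colouring = pathSum-mono λ x y → ≤-reflexive (cong 𝟙 (coloured-colouring x y))

-- Balance would give at most one more plus edge than minus edges, so n - 1 ≤ 2(2s + c) + 1, which
-- falls short of 4s + 2c + 2.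
unbalanced : ∀ {n} (f : Colouring n) s c → 4 * s + 2 * c + 3 ≤ n →
  (∀ P → colourSum f minus (vertices P) ≤ 2 * s + c) → ∀ P → ¬ (∣ weight f P ∣ ≤ 1)
unbalanced {n} f s c n≥ few P small = <⇒≱ (≤-<-trans n≤ (≤-trans (≤-reflexive (size s c)) n≥)) ≤-refl
  where
  open ≤-Reasoning
  p = colourSum f plus (vertices P)
  m = colourSum f minus (vertices P)
  size : ∀ s c → suc (suc (suc ((2 * s + c) + (2 * s + c)))) ≡ 4 * s + 2 * c + 3
  size = solve-∀
  0<n : 0 < n
  0<n = ≤-trans (≤-trans (s≤s z≤n) (≤-reflexive (size s c))) n≥
  n≤ : n ≤ suc (suc ((2 * s + c) + (2 * s + c)))
  n≤ = begin
    n                                          ≡⟨ pathSum-total (vertices P) 0<n (trans (length-map _ (allFin n)) (length-tabulate {n = n} id)) ⟨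
    suc (pathSum (λ _ _ → 1) (vertices P))     ≡⟨ cong suc (colourSum-total f (vertices P)) ⟨
    suc (p + m)                                ≤⟨ s≤s (+-monoˡ-≤ m (∣⊖∣≤1⇒≤ (subst (λ w → ∣ w ∣ ≤ 1) (pathWeight-⊖ f (vertices P)) small))) ⟩
    suc (suc (m + m))                          ≤⟨ s≤s (s≤s (+-mono-≤ (few P) (few P))) ⟩
    suc (suc ((2 * s + c) + (2 * s + c)))      ∎

-- Binomial coefficients and the parameters

-- Induction on `s` by Pascal's rule. Naming the difference `D` keeps the identity free of truncated
-- subtraction.
C2-gap : ∀ s m → ∃ λ D → (s + m) C 2 ≡ D + m C 2 × 2 * D + (s * s + s) ≡ 2 * (s + m) * s
C2-gap zero    m = 0 , refl , sym (*-zeroʳ (2 * m))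
C2-gap (suc s) m with D , D≡ , eq ← C2-gap s m = s + m + D , (begin
    suc (s + m) C 2                ≡⟨ nCk+nC[k+1]≡[n+1]C[k+1] (s + m) 1 ⟨
    (s + m) C 1 + (s + m) C 2      ≡⟨ cong₂ _+_ (nC1≡n (s + m)) D≡ ⟩
    s + m + (D + m C 2)            ≡⟨ +-assoc (s + m) D (m C 2) ⟨
    s + m + D + m C 2              ∎) , (begin
    2 * (s + m + D) + (suc s * suc s + suc s)          ≡⟨ before s m D ⟩
    2 * D + (s * s + s) + (4 * s + 2 * m + 2)          ≡⟨ cong (_+ (4 * s + 2 * m + 2)) eq ⟩
    2 * (s + m) * s + (4 * s + 2 * m + 2)              ≡⟨ after s m ⟩
    2 * (suc s + m) * suc s                            ∎)
  where
  open ≡-Reasoning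
  before : ∀ s m D → 2 * (s + m + D) + (suc s * suc s + suc s) ≡ 2 * D + (s * s + s) + (4 * s + 2 * m + 2)
  before = solve-∀
  after : ∀ s m → 2 * (s + m) * s + (4 * s + 2 * m + 2) ≡ 2 * (suc s + m) * suc s
  after = solve-∀

C2-threshold : ∀ {n s} c → s ≤ n → Threshold n s c (2 * ((n C 2) ∸ ((n ∸ s) C 2) + c))
C2-threshold {n} {s} c s≤n with D , D≡ , eq ← C2-gap s (n ∸ s) rewrite m+[n∸m]≡n s≤n = begin
  2 * ((n C 2) ∸ ((n ∸ s) C 2) + c) + (s * s + s)
    ≡⟨ cong (λ a → 2 * (a + c) + (s * s + s)) (trans (cong (_∸ ((n ∸ s) C 2)) D≡) (m+n∸n≡m D ((n ∸ s) C 2))) ⟩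
  2 * (D + c) + (s * s + s)
    ≡⟨ spread D c (s * s + s) ⟩
  2 * D + (s * s + s) + 2 * c
    ≡⟨ cong (_+ 2 * c) eq ⟩
  2 * n * s + 2 * c ∎
  where
  open ≡-Reasoning
  spread : ∀ D c a → 2 * (D + c) + a ≡ 2 * D + a + 2 * c
  spread = solve-∀

threshold≤half : ∀ {n} (f : Colouring n) s c r → n ≡ 4 * s + 2 * c + 3 + r →
  Threshold n s c (2 * e f minus) → e f minus ≤ e f plus
threshold≤half {n} f s c r n≡ eq = *-cancelˡ-≤ 2 (+-cancelˡ-≤ (E + n) _ _ (begin
  E + n + E
    -- The summand is the exact slack in 4e(-1) ≤ n(n-1). Writing `w` for n - 3 turns its part 2cn -
    -- 4c into `2 * c + 2 * c * w`.
    ≤⟨ m≤m+n _ (2 * (s * s + s) + (2 * c + 2 * c * w + r * n + 2 * n)) ⟩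
  E + n + E + (2 * (s * s + s) + (2 * c + 2 * c * w + r * n + 2 * n))
    ≡⟨ collect E n (s * s + s) _ ⟩
  E + (s * s + s) + (E + (s * s + s)) + n + (2 * c + 2 * c * w + r * n + 2 * n)
    ≡⟨ cong (λ a → a + a + n + (2 * c + 2 * c * w + r * n + 2 * n)) eq ⟩
  2 * n * s + 2 * c + (2 * n * s + 2 * c) + n + (2 * c + 2 * c * w + r * n + 2 * n)
    ≡⟨ cong (λ n → 2 * n * s + 2 * c + (2 * n * s + 2 * c) + n + (2 * c + 2 * c * w + r * n + 2 * n)) n≡w+3 ⟩
  2 * (w + 3) * s + 2 * c + (2 * (w + 3) * s + 2 * c) + (w + 3) + (2 * c + 2 * c * w + r * (w + 3) + 2 * (w + 3))
    ≡⟨ expand w s c r ⟩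
  (w + 3) * (4 * s + 2 * c + 3 + r)
    ≡⟨ cong₂ _*_ n≡w+3 n≡ ⟨
  n * n
    ≡⟨ e-total f ⟨
  E + 2 * e f plus + n
    ≡⟨ swap E (2 * e f plus) n ⟩
  E + n + 2 * e f plus ∎))
  where
  open ≤-Reasoning
  E = 2 * e f minus
  w = 4 * s + 2 * c + r
  n≡w+3 : n ≡ w + 3
  n≡w+3 = trans n≡ (swap (4 * s + 2 * c) 3 r)
    where
    swap : ∀ a b c → a + b + c ≡ a + c + b
    swap = solve-∀
  swap : ∀ a b c → a + b + c ≡ a + c + b
  swap = solve-∀
  collect : ∀ E n S R → E + n + E + (2 * S + R) ≡ E + S + (E + S) + n + R
  collect = solve-∀
  expand : ∀ w s c r → 2 * (w + 3) * s + 2 * c + (2 * (w + 3) * s + 2 * c) + (w + 3)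
    + (2 * c + 2 * c * w + r * (w + 3) + 2 * (w + 3)) ≡ (w + 3) * (4 * s + 2 * c + 3 + r)
  expand = solve-∀

-- For this `n`, the quantity ⌊(n-1)/2⌋ - 1 is 2s + c.
parity : ∀ s {c r} → c ≤ 1 → r ≤ 1 → ((4 * s + 2 * c + 3 + r ∸ 1) / 2 ∸ 1) % 2 ≡ c
parity s {c} {r} c≤1 r≤1 = begin
  ((4 * s + 2 * c + 3 + r ∸ 1) / 2 ∸ 1) % 2    ≡⟨ cong (λ a → ((a ∸ 1) / 2 ∸ 1) % 2) (size s c r) ⟩
  ((r + suc (c + s * 2) * 2) / 2 ∸ 1) % 2      ≡⟨ cong (λ a → (a ∸ 1) % 2) (+-distrib-/-∣ʳ r (n∣m*n (suc (c + s * 2)))) ⟩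
  (r / 2 + suc (c + s * 2) * 2 / 2 ∸ 1) % 2    ≡⟨ cong₂ (λ a b → (a + b ∸ 1) % 2) (m<n⇒m/n≡0 (s≤s r≤1)) (m*n/n≡m (suc (c + s * 2)) 2) ⟩
  (c + s * 2) % 2                              ≡⟨ [m+kn]%n≡m%n c s 2 ⟩
  c % 2                                        ≡⟨ m<n⇒m%n≡m (s≤s c≤1) ⟩
  c                                            ∎
  where
  open ≡-Reasoning
  size : ∀ s c r → 4 * s + 2 * c + 3 + r ≡ suc (r + suc (c + s * 2) * 2)
  size = solve-∀

-- `c` and `r` are the two binary digits of the remainder of n - 3 modulo 4.
decompose : ∀ n → 3 ≤ n → ∃₂ λ c r → c ≤ 1 × r ≤ 1 × n ≡ 4 * ((n ∸ 3) / 4) + 2 * c + 3 + r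
decompose n 3≤n = t / 2 , t % 2 , ≤-pred (m<n*o⇒m/o<n (m%n<n (n ∸ 3) 4)) , ≤-pred (m%n<n t 2) , (begin
  n                                              ≡⟨ m+[n∸m]≡n 3≤n ⟨
  3 + (n ∸ 3)                                    ≡⟨ cong (3 +_) (m≡m%n+[m/n]*n (n ∸ 3) 4) ⟩
  3 + (t + s * 4)                                ≡⟨ cong (λ t → 3 + (t + s * 4)) (m≡m%n+[m/n]*n t 2) ⟩
  3 + (t % 2 + t / 2 * 2 + s * 4)                ≡⟨ size s (t / 2) (t % 2) ⟩
  4 * s + 2 * (t / 2) + 3 + t % 2                ∎)
  where
  open ≡-Reasoning
  s = (n ∸ 3) / 4
  t = (n ∸ 3) % 4
  size : ∀ s c r → 3 + (r + c * 2 + s * 4) ≡ 4 * s + 2 * c + 3 + r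
  size = solve-∀

theorem4p2 : (n : ℕ) → 3 ≤ n → (c : ℕ) → c ≤ 1 → ((n ∸ 1) / 2 ∸ 1) % 2 ≡ c →
    ((f : Colouring n) →
    (n C 2) ∸ ((n ∸ (n ∸ 3) / 4) C 2) + c < e f minus →
    (n C 2) ∸ ((n ∸ (n ∸ 3) / 4) C 2) + c < e f plus →
    Σ (SpanningPath n) (λ P → ∣ weight f P ∣ ≤ 1))
    × Σ (Colouring n) (λ f →
    (((e f minus ≤ e f plus) × (e f minus ≡ (n C 2) ∸ ((n ∸ (n ∸ 3) / 4) C 2) + c))
    ⊎ ((e f plus ≤ e f minus) × (e f plus ≡ (n C 2) ∸ ((n ∸ (n ∸ 3) / 4) C 2) + c)))
    × ((P : SpanningPath n) → ¬ (∣ weight f P ∣ ≤ 1)))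
theorem4p2 n 3≤n c c≤1 c≡ with c′ , r , c′≤1 , r≤1 , n≡ ← decompose n 3≤n
  -- The congruence determines `c`, so the given value is the digit supplied by `decompose`.
  with refl ← trans (sym (trans (cong (λ n → ((n ∸ 1) / 2 ∸ 1) % 2) n≡) (parity ((n ∸ 3) / 4) c′≤1 r≤1))) c≡
  = (λ f many⁻ many⁺ → balanced-path f s c r c≤1 r≤1 n≡ (dense many⁻) (dense many⁺))
  -- The minus class is the smaller one. Its size follows by comparing two doubled thresholds and
  -- cancelling.
  , f₀ , inj₁ (threshold≤half f₀ s c r n≡ 2e≡ , *-cancelˡ-≡ _ _ 2 (+-cancelʳ-≡ (s * s + s) _ _ (trans 2e≡ (sym T≡))))
  , unbalanced f₀ s c n≥ (λ P → ≤-trans (colourSum-colouring G (vertices P)) (proj₂ (proj₂ ex) P))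
  where
  s = (n ∸ 3) / 4
  n≥ : 4 * s + 2 * c + 3 ≤ n
  n≥ = ≤-trans (m≤m+n _ r) (≤-reflexive (sym n≡))
  T≡ : Threshold n s c (2 * ((n C 2) ∸ ((n ∸ s) C 2) + c))
  T≡ = C2-threshold c (≤-trans (m/n≤m (n ∸ 3) 4) (m∸n≤m n 3))
  dense : ∀ {E} → (n C 2) ∸ ((n ∸ s) C 2) + c < E → 2 * n * s + 2 * c < 2 * E + (s * s + s)
  dense {E} lt = subst (_< 2 * E + (s * s + s)) T≡ (+-monoˡ-< (s * s + s) (*-monoʳ-< 2 lt))
  ex = extremal {n} s c c≤1 n≥
  G = proj₁ ex
  f₀ = colouring G
  2e≡ : Threshold n s c (2 * e f₀ minus)
  2e≡ = trans (cong (_+ (s * s + s)) (2e-colouring G)) (proj₁ (proj₂ ex))
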